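{- Let $k\ge 1$. For all $\Upsilon\subseteq\mathcal{F}_{2,k}$, $$N^{\Upsilon}(x,t)=\frac{A^{\Upsilon}(t)}{1-x\left(1+\left(\frac{t}{k!}-1\right)A^{\Upsilon}(t)\right)},$$ where $$N^{\Upsilon}(x,t)=1+\sum_{n\ge 1}\frac{t^n}{(kn)!}\sum_{F\in\mathcal{F}_{n,k}}x^{\Upsilon\text{ -nlap}(F)},\qquad A^{\Upsilon}(t)=1+\sum_{n\ge 1}\frac{A^{\Upsilon}_{n,k}t^n}{(kn)!}.$$
   Context: $\mathcal{F}_{n,k}$ is the set of all fillings $F$ of the $k\times n$ rectangular array ($k$ rows, $n$ columns) with the integers $1,\dots,kn$, each used once, such that the elements in each column increase from bottom to top. For a filling of a $k\times n$ array by distinct positive integers with columns increasing from bottom to top, $\mathrm{red}(F)\in\mathcal{F}_{n,k}$ is obtained by replacing the $i$-th smallest entry by $i$. $F[c_1,\dots,c_j]$ is the filling of the $k\times j$ array whose $a$-th column is column $c_a$ of $F$. For $\Upsilon\subseteq\mathcal{F}_{2,k}$, $F\in\mathcal{F}_{n,k}$ has an $\Upsilon$-match starting at position $i$ ($1\le i\le n-1$) if $\mathrm{red}(F[i,i+1])\in\Upsilon$. Two $\Upsilon$-matches overlap if they share a common column; $\Upsilon\text{ -nlap}(F)$ is the maximum number of (pairwise) nonoverlapping $\Upsilon$-matches in $F$. $A^{\Upsilon}_{n,k}$ is the number of $F\in\mathcal{F}_{n,k}$ that have no $\Upsilon$-matches. The identity is one of formal power series in $t$ with coefficients in $\mathbb{Q}[x]$.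 -}

module Defs where

open import Algebra.Bundles.Raw using (RawRing)
import Algebra.Definitions as AlgebraDefinitions
import Algebra.Definitions.RawMonoid as RawMonoidDefinitions
import Algebra.Definitions.RawSemiring as RawSemiringDefinitions
open import Data.Fin.Base as Fin using (Fin; toℕ; inject₁)
import Data.Fin.Properties as Fin
open import Data.Fin.Subset as Subset using (Subset; ∣_∣; inside; outside)
import Data.Fin.Subset.Properties as Subset
open import Data.Integer.Base using (+_)
open import Data.List.Base as List using (List; []; _∷_; [_]; cartesianProductWith)
open import Data.List.Extrema.Nat using (max)
open import Data.List.Membership.Propositional using (_∈_)
open import Data.List.Membership.Propositional.Properties
  using (∈-filter⁺; ∈-filter⁻; ∈-cartesianProductWith⁺)
import Data.List.Properties as List
open import Data.List.Relation.Binary.Equality.Propositional using (≋⇒≡)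
open import Data.List.Relation.Binary.Permutation.Propositional
  using (_↭_; ↭-sym; ↭-trans; ↭-reflexive; ↭⇒↭ₛ)
open import Data.List.Relation.Binary.Permutation.Propositional.Properties using (∈-resp-↭)
open import Data.List.Relation.Unary.All using ([]; _∷_)
open import Data.List.Relation.Unary.Any using (here; there)
open import Data.List.Relation.Unary.AllPairs using ([]; _∷_)
import Data.List.Relation.Unary.Sorted.TotalOrder.Properties as Sorted
open import Data.List.Relation.Unary.Unique.Propositional using (Unique)
import Data.List.Relation.Unary.Unique.Propositional.Properties as Unique
open import Data.Nat.Base using (ℕ; zero; suc; _∸_; _!; _<_)
open import Data.Nat.Properties using (_≤?_; _<?_; _≟_; _!≢0; suc-injective; ≤-decTotalOrder)
open import Data.Product.Base using (∃; Σ-syntax; _×_; _,_; proj₂)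
open import Data.Rational.Base as ℚ using (ℚ)
open import Data.Vec.Base as Vec using (Vec; []; _∷_; concat; toList; lookup; count)
import Data.Vec.Membership.DecPropositional as VecDecMembership
import Data.Vec.Membership.Propositional as Vec
import Data.Vec.Properties as Vec
open import Data.Vec.Relation.Unary.All using (All; []; _∷_; all?)
open import Data.Vec.Relation.Unary.Any using (here; there)
open import Data.Vec.Relation.Unary.Linked using (Linked; linked?)
open import Data.Vec.Membership.Propositional.Properties using (∈-toList⁺; ∈-++⁺ˡ; ∈-++⁺ʳ)
open import Function.Base using (_∘_)
open import Level using (Level; 0ℓ)
open import Relation.Binary.Core using (Rel)
open import Relation.Binary.Bundles using (DecTotalOrder)
open import Relation.Binary.PropositionalEquality using (_≡_; _≢_; refl)
open import Relation.Nullary using (¬_; Dec)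
open import Relation.Nullary.Decidable using (map′; ¬?; _×-dec_; _→-dec_)
open import Relation.Unary using (Pred; Decidable)

-- Unlike the default merge sort, insertion sort evaluates on closed lists.
open import Data.List.Sort.InsertionSort ≤-decTotalOrder using (insertionSort)
open import Data.List.Sort.Base (DecTotalOrder.totalOrder ≤-decTotalOrder)
  using (module SortingAlgorithm)

open SortingAlgorithm insertionSort using (sort; sort-↭; sort-↗)

private
  variable
    a c ℓ : Level
    j k m n : ℕ

------------------------------------------------------------------------
-- Polynomials and formal power series

-- A polynomial is its list of coefficients, constant term first; trailing
-- zeros are immaterial, as equality is equality of all coefficients.
module Polynomial (R : RawRing c ℓ) where
  private module R = RawRing R

  coeff : List R.Carrier → ℕ → R.Carrier
  coeff []      _       = R.0#
  coeff (a ∷ _) zero    = a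
  coeff (_ ∷ p) (suc i) = coeff p i

  add : List R.Carrier → List R.Carrier → List R.Carrier
  add []      q       = q
  add (a ∷ p) []      = a ∷ p
  add (a ∷ p) (b ∷ q) = (a R.+ b) ∷ add p q

  mul : List R.Carrier → List R.Carrier → List R.Carrier
  mul []      q = []
  mul (a ∷ p) q = add (List.map (a R.*_) q) (R.0# ∷ mul p q)

  rawRing : RawRing c ℓ
  rawRing = record
    { Carrier = List R.Carrier
    ; _≈_     = λ p q → ∀ i → coeff p i R.≈ coeff q i
    ; _+_     = add
    ; _*_     = mul
    ; -_      = List.map (R.-_)
    ; 0#      = []
    ; 1#      = [ R.1# ]
    }

  constant : R.Carrier → List R.Carrier
  constant a = [ a ]

  indeterminate : List R.Carrier
  indeterminate = R.0# ∷ R.1# ∷ []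

module PowerSeries (R : RawRing c ℓ) where
  private module R = RawRing R
  open RawMonoidDefinitions R.+-rawMonoid using (sum)

  constant : R.Carrier → ℕ → R.Carrier
  constant a zero    = a
  constant a (suc _) = R.0#

  indeterminate : ℕ → R.Carrier
  indeterminate (suc zero) = R.1#
  indeterminate _          = R.0#

  rawRing : RawRing c ℓ
  rawRing = record
    { Carrier = ℕ → R.Carrier
    ; _≈_     = λ f g → ∀ n → f n R.≈ g n
    ; _+_     = λ f g n → f n R.+ g n
    ; _*_     = λ f g n → sum {suc n} λ i → f (toℕ i) R.* g (n ∸ toℕ i)
    ; -_      = λ f n → R.- f n
    ; 0#      = λ _ → R.0#
    ; 1#      = constant R.1#
    }

ℚ[x] : RawRing 0ℓ 0ℓ
ℚ[x] = Polynomial.rawRing ℚ.+-*-rawRing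

ℚ[x]⟦t⟧ : RawRing 0ℓ 0ℓ
ℚ[x]⟦t⟧ = PowerSeries.rawRing ℚ[x]

module ℚ[x] where
  open RawRing ℚ[x] public
  open RawMonoidDefinitions +-rawMonoid public using () renaming (_×_ to _·_)
  open RawSemiringDefinitions rawSemiring public using (_^_)

  const : ℚ → Carrier
  const = Polynomial.constant ℚ.+-*-rawRing

  x : Carrier
  x = Polynomial.indeterminate ℚ.+-*-rawRing

  ∑ : {A : Set a} → List A → (A → Carrier) → Carrier
  ∑ as f = List.foldr (λ a s → f a + s) 0# as

module Series where
  open RawRing ℚ[x]⟦t⟧ public
  open AlgebraDefinitions _≈_ using (Invertible)

  infixl 6 _-_
  _-_ : Carrier → Carrier → Carrier
  f - g = f + (- g)

  -- f ≈ g / h means that h is a unit and that f is g times its inverse.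
  infix 4 _≈_/_
  _≈_/_ : Carrier → Carrier → Carrier → Set
  f ≈ g / h = Σ[ (h⁻¹ , _) ∈ Invertible 1# _*_ h ] f ≈ g * h⁻¹

  const : ℚ → Carrier
  const = PowerSeries.constant ℚ[x] ∘ ℚ[x].const

  x : Carrier
  x = PowerSeries.constant ℚ[x] ℚ[x].x

  t : Carrier
  t = PowerSeries.indeterminate ℚ[x]

1/_! : ℕ → ℚ
1/ n ! = ℚ._/_ (+ 1) (n !) {{n !≢0}}

------------------------------------------------------------------------
-- Fillings

open import Data.Nat.Base using (_*_)

-- k rows and n columns, stored as the vector of columns, each column
-- being listed from bottom to top.
Array : ℕ → ℕ → Set
Array k n = Vec (Vec ℕ k) n

entries : Array k n → List ℕ
entries F = toList (concat F)

[1⋯_] : ℕ → List ℕ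
[1⋯ n ] = List.map suc (List.upTo n)

IsFilling : Pred (Array k n) 0ℓ
IsFilling {k} {n} F = entries F ↭ [1⋯ k * n ] × All (Linked _<_) F

_↭?_ : (xs ys : List ℕ) → Dec (xs ↭ ys)
xs ↭? ys = map′ to from (List.≡-dec _≟_ (sort xs) (sort ys))
  where
  to : sort xs ≡ sort ys → xs ↭ ys
  to eq = ↭-trans (↭-sym (sort-↭ xs)) (↭-trans (↭-reflexive eq) (sort-↭ ys))

  from : xs ↭ ys → sort xs ≡ sort ys
  from xs↭ys = ≋⇒≡ (Sorted.↗↭↗⇒≋ (DecTotalOrder.totalOrder ≤-decTotalOrder)
    (sort-↗ xs) (sort-↗ ys)
    (↭⇒↭ₛ (↭-trans (sort-↭ xs) (↭-trans xs↭ys (↭-sym (sort-↭ ys))))))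

isFilling? : Decidable (IsFilling {k} {n})
isFilling? F = (entries F ↭? _) ×-dec all? (linked? _<?_) F

vectors : {A : Set a} → List A → ∀ n → List (Vec A n)
vectors as zero    = [ [] ]
vectors as (suc n) = cartesianProductWith _∷_ as (vectors as n)

𝓕 : ∀ n k → List (Array k n)
𝓕 n k = List.filter isFilling? (vectors (vectors [1⋯ k * n ] k) n)

∈-vectors : {A : Set a} {as : List A} {v : Vec A n} → All (_∈ as) v → v ∈ vectors as n
∈-vectors []         = here refl
∈-vectors (px ∷ pxs) = ∈-cartesianProductWith⁺ _∷_ px (∈-vectors pxs)

vectors-unique : {A : Set a} {as : List A} → Unique as → ∀ n → Unique (vectors as n)
vectors-unique u zero    = [] ∷ []
vectors-unique u (suc n) =
  Unique.cartesianProductWith⁺ _∷_ Vec.∷-injective u (vectors-unique u n)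

∈-𝓕⁻ : {F : Array k n} → F ∈ 𝓕 n k → IsFilling F
∈-𝓕⁻ {k} {n} F∈ =
  proj₂ (∈-filter⁻ isFilling? {xs = vectors (vectors [1⋯ k * n ] k) n} F∈)

∈-𝓕⁺ : {F : Array k n} → IsFilling F → F ∈ 𝓕 n k
∈-𝓕⁺ {k} {n} {F} F-filling@(perm , _) =
  ∈-filter⁺ isFilling? (∈-vectors (columns F λ e∈ → ∈-resp-↭ perm (∈-toList⁺ e∈))) F-filling
  where
  labels : List ℕ
  labels = [1⋯ k * n ]

  column : ∀ {i} (v : Vec ℕ i) → (∀ {e} → e Vec.∈ v → e ∈ labels) → All (_∈ labels) v
  column []      _ = []
  column (e ∷ v) h = h (here refl) ∷ column v (h ∘ there)

  columns : ∀ {i} (G : Array k i) → (∀ {e} → e Vec.∈ concat G → e ∈ labels) →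
            All (_∈ vectors labels k) G
  columns []      _ = []
  columns (v ∷ G) h = ∈-vectors (column v (h ∘ ∈-++⁺ˡ)) ∷ columns G (h ∘ ∈-++⁺ʳ v)

𝓕-unique : ∀ n k → Unique (𝓕 n k)
𝓕-unique n k = Unique.filter⁺ isFilling?
  (vectors-unique (vectors-unique (Unique.map⁺ suc-injective (Unique.upTo⁺ (k * n))) k) n)

-- For distinct entries, the i-th smallest entry is the one that has
-- exactly i entries less than or equal to it.
red : Array k n → Array k n
red F = Vec.map (Vec.map λ e → count (_≤? e) (concat F)) F

infix 9 _⟦_⟧
_⟦_⟧ : Array k n → Vec (Fin n) j → Array k j
F ⟦ cs ⟧ = Vec.map (lookup F) cs

------------------------------------------------------------------------
-- Matches

-- An array with m + 1 columns has m possible starting positions.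
columnsAt : Fin m → Vec (Fin (suc m)) 2
columnsAt i = inject₁ i ∷ Fin.suc i ∷ []

Overlap : Rel (Fin m) 0ℓ
Overlap i j = ∃ λ c → c Vec.∈ columnsAt i × c Vec.∈ columnsAt j

overlap? : (i j : Fin m) → Dec (Overlap i j)
overlap? i j = Fin.any? λ c → (c ∈? columnsAt i) ×-dec (c ∈? columnsAt j)
  where open VecDecMembership Fin._≟_ using (_∈?_)

module _ (Υ : Pred (Array k 2) ℓ) where

  MatchAt : Array k (suc m) → Pred (Fin m) ℓ
  MatchAt F i = Υ (red (F ⟦ columnsAt i ⟧))

  NoMatch : Pred (Array k (suc m)) ℓ
  NoMatch F = ∀ i → ¬ MatchAt F i

  NonoverlappingMatches : Array k (suc m) → Pred (Subset m) ℓ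
  NonoverlappingMatches F S =
    (∀ i → i Subset.∈ S → MatchAt F i) ×
    (∀ i j → i Subset.∈ S → j Subset.∈ S → i ≢ j → ¬ Overlap i j)

module _ {Υ : Pred (Array k 2) ℓ} (Υ? : Decidable Υ) where

  matchAt? : (F : Array k (suc m)) → Decidable (MatchAt Υ F)
  matchAt? F i = Υ? (red (F ⟦ columnsAt i ⟧))

  noMatch? : Decidable (NoMatch Υ {m})
  noMatch? F = Fin.all? λ i → ¬? (matchAt? F i)

  nonoverlappingMatches? : (F : Array k (suc m)) → Decidable (NonoverlappingMatches Υ F)
  nonoverlappingMatches? F S =
    Fin.all? (λ i → (i Subset.∈? S) →-dec matchAt? F i) ×-dec
    Fin.all? (λ i → Fin.all? λ j →
      (i Subset.∈? S) →-dec ((j Subset.∈? S) →-dec (¬? (i Fin.≟ j) →-dec ¬? (overlap? i j))))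

  nlap : Array k (suc m) → ℕ
  nlap {m} F = max 0 (List.map ∣_∣
    (List.filter (nonoverlappingMatches? F) (vectors (outside ∷ inside ∷ []) m)))

------------------------------------------------------------------------
-- Generating functions

  matchFreeCount : ℕ → ℕ
  matchFreeCount m = List.length (List.filter noMatch? (𝓕 (suc m) k))

  N : Series.Carrier
  N zero      = ℚ[x].1#
  N n@(suc _) = ℚ[x].const (1/ (k * n) !) ℚ[x].* ℚ[x].∑ (𝓕 n k) λ F → ℚ[x].x ℚ[x].^ nlap F

  A : Series.Carrier
  A zero      = ℚ[x].1#
  A n@(suc m) = ℚ[x].const (1/ (k * n) !) ℚ[x].* (matchFreeCount m ℚ[x].· ℚ[x].1#)

{-# OPTIONS --safe #-}
module Submission where

-- A weight is a function from arrays to a commutative ring.  For weights f and g,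
-- let (f ⋆ g) F be the sum of f F₁ * g F₂ over all ways to cut F between columns
-- into an initial part F₁ and a final part F₂, and let egf f be the power series
-- whose coefficient of t^n is 1/(kn)! times the sum of f over all fillings with n
-- columns.  If f and g depend only on the relative order of the entries, then
-- egf (f ⋆ g) = egf f * egf g (lemma egf-⋆): the labels 1, ..., kn can be
-- distributed over i initial and n - i final columns in (kn choose ki) ways, and
-- the sum of f over the fillings with a given set of labels depends only on the size
-- of that set.  So an identity between weights, which is verified one array
-- at a time, becomes an identity between power series.
--
-- Let a be the indicator of the arrays without matches, b that of the arrays
-- whose first match is formed by the last two columns, e that of the empty
-- array, s that of the arrays with one column, and w = x^nlap.  Deleting the last
-- column shows b + a = e + a ⋆ s (lemma endsWithFirst-matchFree).  A maximum set of
-- nonoverlapping matches is found greedily, by choosing the first match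
-- and going on behind it (lemma nlap≡greedy), so that w = a + x * (b ⋆ w) (lemma
-- greedy-decomposition).  With A, B, N the series of a, b, w, and t/k! that
-- of s, this means B = 1 + (t/k! - 1) A and N = A + x B N.  Hence
-- N (1 - x B) = A, and 1 - x B is invertible because its constant coefficient is 1.
--
-- These computations need that power series over a commutative ring form a
-- commutative ring, and that polynomials do; the latter are embedded into the
-- power series by their coefficients.

open import Defs
import Algebra.Definitions as AlgebraDefinitions
open import Algebra.Bundles using (CommutativeRing)
open import Algebra.Bundles.Raw using (RawRing)
import Algebra.Definitions.RawMonoid as RawMonoidDefinitions
import Algebra.Definitions.RawSemiring as RawSemiringDefinitions
import Algebra.Morphism.RingMonomorphism as RingMonomorphism
open import Algebra.Morphism.Structures using (IsRingMonomorphism)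
import Algebra.Properties.Ring as RingProperties
import Algebra.Properties.Semiring.Mult as Mult
import Algebra.Properties.Semiring.Sum as Sum
import Algebra.Solver.Ring.NaturalCoefficients.Default as SemiringSolver
open import Data.Bool.Base using (Bool; true; false; if_then_else_)
open import Data.Bool.Properties using (if-cong; if-cong₂; if-cong-else)
open import Data.Fin.Base as Fin using (Fin; toℕ)
import Data.Fin.Properties as Fin
open import Data.Fin.Subset as Subset using (Subset; ∣_∣; inside; outside)
import Data.Integer.Base as ℤ
import Data.Integer.Properties as ℤ
open import Data.List.Base as List using (List; []; _∷_; _++_; concatMap; length; upTo)
open import Data.List.Extrema.Nat using (max≈v⁺)
open import Data.List.Membership.Propositional using (_∈_; _∉_; find; lose)
open import Data.List.Membership.Propositional.Properties
  using (∈-++⁺ˡ; ∈-++⁺ʳ; ∈-++⁻; ∈-map⁺; ∈-map⁻; ∈-∃++; ∈-concatMap⁺; ∈-concatMap⁻; ∈-filter⁺)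
import Data.List.Membership.Propositional.Properties.WithK as Membership
import Data.List.Properties as List
open import Data.List.Relation.Binary.BagAndSetEquality using (∼bag⇒↭)
open import Data.List.Relation.Binary.Permutation.Propositional as Perm
  using (_↭_; ↭-refl; ↭-sym; ↭-trans; ↭-reflexive)
open import Data.List.Relation.Binary.Permutation.Propositional.Properties as Perm
  using (∈-resp-↭; ↭-length; ++⁺ˡ; drop-∷; ↭-empty-inv)
import Data.List.Relation.Binary.Pointwise as Pointwise
open import Data.List.Relation.Ternary.Interleaving.Propositional
  using (Interleaving; []; consˡ; consʳ; right; toPermutation)
open import Data.List.Relation.Unary.All as All using (All; []; _∷_)
import Data.List.Relation.Unary.All.Properties as All
open import Data.List.Relation.Unary.AllPairs as AllPairs using (AllPairs; []; _∷_)
import Data.List.Relation.Unary.AllPairs.Properties as AllPairs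
open import Data.List.Relation.Unary.Any using (here; there)
open import Data.List.Relation.Unary.Unique.Propositional using (Unique)
import Data.List.Relation.Unary.Unique.Propositional.Properties as Unique
open import Data.Nat.Base as ℕ
  using (ℕ; zero; suc; _≤_; _<_; z≤n; s≤s; s<s; _∸_; _!; NonZero)
open import Data.Nat.Combinatorics
  using (_C_; nCk+nC[k+1]≡[n+1]C[k+1]; nCk≡n!/k![n-k]!; [n∸k]!k!∣n!; nCn≡1)
import Data.Nat.Divisibility as ℕ
open import Data.Nat.DivMod using (m/n*n≡m)
import Data.Nat.Properties as ℕ
open import Data.Product.Base
  using (Σ-syntax; ∃; _×_; _,_; proj₁; proj₂; map₁; map₂; uncurry)
import Data.Rational.Base as ℚ
import Data.Rational.Properties as ℚ
import Data.Rational.Unnormalised.Base as ℚᵘ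
import Data.Rational.Unnormalised.Properties as ℚᵘ
open import Data.Sum.Base using (inj₁; inj₂)
open import Data.Vec.Base as Vec using (Vec; []; _∷_; concat; count; here; there; toList)
import Data.Vec.Membership.Propositional as Vec
import Data.Vec.Membership.Propositional.Properties as VecMembership
import Data.Vec.Properties as Vec
open import Data.Vec.Relation.Unary.All as VecAll using ([]; _∷_)
open import Data.Vec.Relation.Unary.Any using (here; there)
open import Data.Vec.Relation.Unary.Linked using (Linked; []; [-]; _∷_)
open import Function.Base using (_∘_; id)
open import Function.Bundles using (mk⇔)
open import Level using (Level; _⊔_)
open import Relation.Binary.Core using (_Preserves_⟶_)
open import Relation.Binary.PropositionalEquality as ≡ using (_≡_; _≢_)
import Relation.Binary.Reasoning.Setoid as ≈-Reasoning
open import Relation.Nullary using (¬_; Dec; does; yes; no; contradiction)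
open import Relation.Nullary.Decidable using (dec-true; dec-false; does-⇔)
open import Relation.Unary using (Pred; Decidable; _⊆_)

private
  variable
    a p ℓ : Level
    X Y : Set a
    i j k m n : ℕ

------------------------------------------------------------------------
-- Formal power series and polynomials

module PowerSeriesRing {c ℓ : Level} (R : CommutativeRing c ℓ) where
  open CommutativeRing R hiding (zero)
  open Sum semiring using (*-distribˡ-sum; ∑-distrib-+; sum-cong-≋)
  open SemiringSolver commutativeSemiring using (solve; con; _:=_; _:+_; _:*_)
  open ≈-Reasoning setoid

  private
    module S = RawRing (PowerSeries.rawRing rawRing)
    module P = PowerSeries rawRing

  infix 4 _≋_
  _≋_ : S.Carrier → S.Carrier → Set ℓ
  f ≋ g = ∀ n → f n ≈ g n

  -- The quotient by t of f without its constant term.  The Cauchy product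
  -- satisfies (f * g) (suc n) = f 0 * g (suc n) + (shift f * g) n by definition, and
  -- the proofs about it are inductions on n along this equation.
  shift : S.Carrier → S.Carrier
  shift f n = f (suc n)

  -- The coefficient of a product at n involves the coefficients up to n only.
  *-congᵗ : ∀ {f f′ g g′} n → (∀ {i} → i ≤ n → f i ≈ f′ i) → (∀ {i} → i ≤ n → g i ≈ g′ i) →
            (f S.* g) n ≈ (f′ S.* g′) n
  *-congᵗ zero    p q = +-congʳ (*-cong (p z≤n) (q z≤n))
  *-congᵗ {f} {f′} (suc n) p q =
    +-cong (*-cong (p z≤n) (q ℕ.≤-refl)) (*-congᵗ {shift f} {shift f′} n (p ∘ s≤s) (q ∘ ℕ.m≤n⇒m≤1+n))

  *-cong-≋ : ∀ {f f′ g g′} → f ≋ f′ → g ≋ g′ → f S.* g ≋ f′ S.* g′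
  *-cong-≋ {f} {f′} p q n = *-congᵗ {f} {f′} n (λ {i} _ → p i) (λ {i} _ → q i)

  *-distribˡ-≋ : ∀ f g h → f S.* (g S.+ h) ≋ f S.* g S.+ f S.* h
  *-distribˡ-≋ f g h n = begin
    (f S.* (g S.+ h)) n
      ≈⟨ sum-cong-≋ (λ i → distribˡ (f (toℕ {suc n} i)) (g (n ∸ toℕ i)) (h (n ∸ toℕ i))) ⟩
    Sum.sum semiring (λ i → f (toℕ {suc n} i) * g (n ∸ toℕ i) + f (toℕ i) * h (n ∸ toℕ i))
      ≈⟨ ∑-distrib-+ {suc n} (λ i → f (toℕ i) * g (n ∸ toℕ i)) (λ i → f (toℕ i) * h (n ∸ toℕ i)) ⟩
    (f S.* g S.+ f S.* h) n ∎

  *-distribʳ-≋ : ∀ f g h → (g S.+ h) S.* f ≋ g S.* f S.+ h S.* f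
  *-distribʳ-≋ f g h n = begin
    ((g S.+ h) S.* f) n
      ≈⟨ sum-cong-≋ (λ i → distribʳ (f (n ∸ toℕ {suc n} i)) (g (toℕ i)) (h (toℕ i))) ⟩
    Sum.sum semiring (λ i → g (toℕ {suc n} i) * f (n ∸ toℕ i) + h (toℕ i) * f (n ∸ toℕ i))
      ≈⟨ ∑-distrib-+ {suc n} (λ i → g (toℕ i) * f (n ∸ toℕ i)) (λ i → h (toℕ i) * f (n ∸ toℕ i)) ⟩
    (g S.* f S.+ h S.* f) n ∎

  scalar-*-assoc : ∀ a f g n → ((λ i → a * f i) S.* g) n ≈ a * (f S.* g) n
  scalar-*-assoc a f g n = begin
    ((λ i → a * f i) S.* g) n
      ≈⟨ sum-cong-≋ (λ i → *-assoc a (f (toℕ {suc n} i)) (g (n ∸ toℕ i))) ⟩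
    Sum.sum semiring (λ i → a * (f (toℕ {suc n} i) * g (n ∸ toℕ i)))
      ≈⟨ *-distribˡ-sum {suc n} a (λ i → f (toℕ i) * g (n ∸ toℕ i)) ⟨
    a * (f S.* g) n ∎

  -- The Cauchy product expanded at its last instead of its first term.
  *-suc : ∀ f g n → (f S.* g) (suc n) ≈ (f S.* shift g) n + f (suc n) * g 0
  *-suc f g zero    = solve 2 (λ x y → x :+ (y :+ con 0) := x :+ con 0 :+ y) refl _ _
  *-suc f g (suc n) = trans (+-congˡ (*-suc (shift f) g n)) (sym (+-assoc _ _ _))

  *-comm-≋ : ∀ f g → f S.* g ≋ g S.* f
  *-comm-≋ f g zero    = +-congʳ (*-comm (f 0) (g 0))
  *-comm-≋ f g (suc n) = begin
    f 0 * g (suc n) + (shift f S.* g) n  ≈⟨ +-comm _ _ ⟩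
    (shift f S.* g) n + f 0 * g (suc n)  ≈⟨ +-cong (*-comm-≋ (shift f) g n) (*-comm (f 0) (g (suc n))) ⟩
    (g S.* shift f) n + g (suc n) * f 0  ≈⟨ *-suc g f n ⟨
    (g S.* f) (suc n)                    ∎

  *-assoc-≋ : ∀ f g h → (f S.* g) S.* h ≋ f S.* (g S.* h)
  *-assoc-≋ f g h zero = begin
    (f 0 * g 0 + 0#) * h 0 + 0#    ≈⟨ +-congʳ (*-congʳ (+-identityʳ _)) ⟩
    f 0 * g 0 * h 0 + 0#           ≈⟨ +-congʳ (*-assoc _ _ _) ⟩
    f 0 * (g 0 * h 0) + 0#         ≈⟨ +-congʳ (*-congˡ (+-identityʳ _)) ⟨
    f 0 * (g 0 * h 0 + 0#) + 0#    ∎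
  *-assoc-≋ f g h (suc n) = begin
    (f S.* g) 0 * h (suc n) + (shift (f S.* g) S.* h) n
      ≈⟨ +-cong (*-congʳ (+-identityʳ _)) (*-distribʳ-≋ h (λ i → f 0 * shift g i) (shift f S.* g) n) ⟩
    f 0 * g 0 * h (suc n) + (((λ i → f 0 * shift g i) S.* h) n + ((shift f S.* g) S.* h) n)
      ≈⟨ +-congˡ (+-cong (scalar-*-assoc (f 0) (shift g) h n) (*-assoc-≋ (shift f) g h n)) ⟩
    f 0 * g 0 * h (suc n) + (f 0 * (shift g S.* h) n + (shift f S.* (g S.* h)) n)
      ≈⟨ solve 5 (λ a b c d e → a :* b :* c :+ (a :* d :+ e) := a :* (b :* c :+ d) :+ e)
           refl (f 0) (g 0) (h (suc n)) ((shift g S.* h) n) ((shift f S.* (g S.* h)) n) ⟩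
    f 0 * (g 0 * h (suc n) + (shift g S.* h) n) + (shift f S.* (g S.* h)) n
      ∎

  *-zeroˡ-≋ : ∀ f g → f ≋ S.0# → f S.* g ≋ S.0#
  *-zeroˡ-≋ f g p zero    = trans (+-congʳ (trans (*-congʳ (p 0)) (zeroˡ _))) (+-identityˡ _)
  *-zeroˡ-≋ f g p (suc n) = trans
    (+-cong (trans (*-congʳ (p 0)) (zeroˡ _)) (*-zeroˡ-≋ (shift f) g (p ∘ suc) n)) (+-identityˡ _)

  constant-* : ∀ a f n → (P.constant a S.* f) n ≈ a * f n
  constant-* a f zero    = +-identityʳ _
  constant-* a f (suc n) = trans (+-congˡ (*-zeroˡ-≋ S.0# f (λ _ → refl) n)) (+-identityʳ _)

  indeterminate-*-suc : ∀ f n → (P.indeterminate S.* f) (suc n) ≈ f n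
  indeterminate-*-suc f n = begin
    0# * f (suc n) + (shift P.indeterminate S.* f) n
      ≈⟨ +-cong (zeroˡ _) (*-cong-≋ {shift P.indeterminate} {S.1#} {f} shift-t (λ _ → refl) n) ⟩
    0# + (S.1# S.* f) n   ≈⟨ +-identityˡ _ ⟩
    (S.1# S.* f) n        ≈⟨ constant-* 1# f n ⟩
    1# * f n              ≈⟨ *-identityˡ _ ⟩
    f n                   ∎
    where
    shift-t : shift P.indeterminate ≋ S.1#
    shift-t zero    = refl
    shift-t (suc _) = refl

  *-identityˡ-≋ : ∀ f → S.1# S.* f ≋ f
  *-identityˡ-≋ f n = trans (constant-* 1# f n) (*-identityˡ (f n))

  commutativeRing : CommutativeRing c ℓ
  commutativeRing = record
    { Carrier = S.Carrier
    ; _≈_     = S._≈_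
    ; _+_     = S._+_
    ; _*_     = S._*_
    ; -_      = S.-_
    ; 0#      = S.0#
    ; 1#      = S.1#
    ; isCommutativeRing = record
      { isRing = record
        { +-isAbelianGroup = record
          { isGroup = record
            { isMonoid = record
              { isSemigroup = record
                { isMagma = record
                  { isEquivalence = record
                    { refl  = λ _ → refl
                    ; sym   = λ p n → sym (p n)
                    ; trans = λ p q n → trans (p n) (q n)
                    }
                  ; ∙-cong = λ p q n → +-cong (p n) (q n)
                  }
                ; assoc = λ f g h n → +-assoc (f n) (g n) (h n)
                }
              ; identity = (λ f n → +-identityˡ (f n)) , (λ f n → +-identityʳ (f n))
              }
            ; inverse = (λ f n → -‿inverseˡ (f n)) , (λ f n → -‿inverseʳ (f n))
            ; ⁻¹-cong = λ p n → -‿cong (p n)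
            }
          ; comm = λ f g n → +-comm (f n) (g n)
          }
        ; *-cong     = λ {f} {f′} {g} {g′} → *-cong-≋ {f} {f′} {g} {g′}
        ; *-assoc    = *-assoc-≋
        ; *-identity = *-identityˡ-≋ , λ f n → trans (*-comm-≋ f S.1# n) (*-identityˡ-≋ f n)
        ; distrib    = *-distribˡ-≋ , *-distribʳ-≋
        }
      ; *-comm = *-comm-≋
      }
    }

  -- The inverse of a series h with h 0 = 1 satisfies the recurrence
  -- g (suc n) = - (shift h * g) n, whose right-hand side involves all of
  -- g 0, ..., g n.  The second argument m of approximation bounds the depth of
  -- the recursion; the coefficients up to m are those of the inverse.
  approximation : S.Carrier → ℕ → S.Carrier
  approximation h _       zero    = 1#
  approximation h zero    (suc n) = 0#
  approximation h (suc m) (suc n) = - (shift h S.* approximation h m) n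

  approximation-stable : ∀ h {m m′} n → n ≤ m → n ≤ m′ → approximation h m n ≈ approximation h m′ n
  approximation-stable h zero    _       _        = refl
  approximation-stable h {suc m} {suc m′} (suc n) (s≤s p) (s≤s q) =
    -‿cong (*-congᵗ {shift h} n (λ _ → refl) λ {i} i≤n →
      approximation-stable h i (ℕ.≤-trans i≤n p) (ℕ.≤-trans i≤n q))

  inverse : S.Carrier → S.Carrier
  inverse h n = approximation h n n

  inverse-correct : ∀ h → h 0 ≈ 1# → h S.* inverse h ≋ S.1#
  inverse-correct h h₀ zero = begin
    h 0 * 1# + 0#  ≈⟨ +-identityʳ _ ⟩
    h 0 * 1#       ≈⟨ *-identityʳ _ ⟩
    h 0            ≈⟨ h₀ ⟩
    1#             ∎
  inverse-correct h h₀ (suc n) = begin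
    h 0 * inverse h (suc n) + (shift h S.* inverse h) n
      ≈⟨ +-cong (trans (*-congʳ h₀) (*-identityˡ _))
           (*-congᵗ {shift h} n (λ _ → refl) λ {i} i≤n → approximation-stable h i ℕ.≤-refl i≤n) ⟩
    - (shift h S.* approximation h n) n + (shift h S.* approximation h n) n
      ≈⟨ -‿inverseˡ _ ⟩
    0# ∎

module PolynomialRing {c ℓ : Level} (R : CommutativeRing c ℓ) where
  open CommutativeRing R hiding (zero)
  open RingProperties ring using (-0#≈0#)
  open Polynomial rawRing using (coeff; add; mul; constant)
  open PowerSeriesRing R using (*-zeroˡ-≋)
  open ≈-Reasoning setoid

  private
    module P = RawRing (Polynomial.rawRing rawRing)
    module S = CommutativeRing (PowerSeriesRing.commutativeRing R)

  coeff-add : ∀ p q → coeff (add p q) S.≈ coeff p S.+ coeff q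
  coeff-add []      q       n       = sym (+-identityˡ _)
  coeff-add (a ∷ p) []      n       = sym (+-identityʳ _)
  coeff-add (a ∷ p) (b ∷ q) zero    = refl
  coeff-add (a ∷ p) (b ∷ q) (suc n) = coeff-add p q n

  coeff-neg : ∀ p → coeff (P.- p) S.≈ S.- coeff p
  coeff-neg []      n       = sym -0#≈0#
  coeff-neg (a ∷ p) zero    = refl
  coeff-neg (a ∷ p) (suc n) = coeff-neg p n

  coeff-scale : ∀ a p n → coeff (List.map (a *_) p) n ≈ a * coeff p n
  coeff-scale a []      n       = sym (zeroʳ a)
  coeff-scale a (b ∷ p) zero    = refl
  coeff-scale a (b ∷ p) (suc n) = coeff-scale a p n

  coeff-mul : ∀ p q → coeff (mul p q) S.≈ coeff p S.* coeff q
  coeff-mul []      q n = sym (*-zeroˡ-≋ S.0# (coeff q) (λ _ → refl) n)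
  coeff-mul (a ∷ p) q zero    = begin
    coeff (mul (a ∷ p) q) 0   ≈⟨ coeff-add (List.map (a *_) q) _ 0 ⟩
    coeff (List.map (a *_) q) 0 + 0# ≈⟨ +-congʳ (coeff-scale a q 0) ⟩
    a * coeff q 0 + 0# ∎
  coeff-mul (a ∷ p) q (suc n) = begin
    coeff (mul (a ∷ p) q) (suc n)   ≈⟨ coeff-add (List.map (a *_) q) _ (suc n) ⟩
    coeff (List.map (a *_) q) (suc n) + coeff (mul p q) n
      ≈⟨ +-cong (coeff-scale a q (suc n)) (coeff-mul p q n) ⟩
    a * coeff q (suc n) + (coeff p S.* coeff q) n ∎

  coeff-1# : coeff P.1# S.≈ S.1#
  coeff-1# zero    = refl
  coeff-1# (suc _) = refl

  coeff-isRingMonomorphism : IsRingMonomorphism (Polynomial.rawRing rawRing) S.rawRing coeff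
  coeff-isRingMonomorphism = record
    { isRingHomomorphism = record
      { isSemiringHomomorphism = record
        { isNearSemiringHomomorphism = record
          { +-isMonoidHomomorphism = record
            { isMagmaHomomorphism = record
              { isRelHomomorphism = record { cong = λ p → p }
              ; homo = coeff-add
              }
            ; ε-homo = λ _ → refl
            }
          ; *-homo = coeff-mul
          }
        ; 1#-homo = coeff-1#
        }
      ; -‿homo = coeff-neg
      }
    ; injective = λ p → p
    }

  commutativeRing : CommutativeRing c ℓ
  commutativeRing = record
    { isCommutativeRing =
        RingMonomorphism.isCommutativeRing coeff-isRingMonomorphism S.isCommutativeRing }

  open RawMonoidDefinitions P.+-rawMonoid using () renaming (_×_ to _·_)
  open RawMonoidDefinitions +-rawMonoid using () renaming (_×_ to _·ᴿ_)

  ·-constant : ∀ n a → (n · constant a) P.≈ constant (n ·ᴿ a)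
  ·-constant zero    a zero    = refl
  ·-constant zero    a (suc _) = refl
  ·-constant (suc n) a i = trans (coeff-add (constant a) (n · constant a) i) (step i)
    where
    step : ∀ i → coeff (constant a) i + coeff (n · constant a) i ≈ coeff (constant (a + n ·ᴿ a)) i
    step zero    = +-congˡ (·-constant n a zero)
    step (suc i) = trans (+-identityˡ _) (·-constant n a (suc i))

------------------------------------------------------------------------
-- Enumerating fillings by splitting the list of labels

-- All ways to distribute the members of a list over a left part of length j and
-- a right part, without changing their order.
splits : ∀ j → List X → List (Vec X j × List X)
splits zero    xs       = ([] , xs) ∷ []
splits (suc j) []       = []
splits (suc j) (x ∷ xs) = List.map (map₁ (x ∷_)) (splits j xs) ++
                          List.map (map₂ (x ∷_)) (splits (suc j) xs)

-- The arrays with n columns that arise by splitting off the columns, one after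
-- the other, from the list of labels.  If L is sorted, then so are the columns.
-- Labels that are left over at the end are ignored; there are none if L has
-- k * n members.
fillings : ∀ n → List ℕ → List (Array k n)
fillings zero    L = [] ∷ []
fillings {k} (suc n) L = concatMap (λ (c , r) → List.map (c ∷_) (fillings n r)) (splits k L)

splits⇒interleaving : ∀ j {xs : List X} {v r} → (v , r) ∈ splits j xs → Interleaving (toList v) r xs
splits⇒interleaving zero    (here ≡.refl) = right (Pointwise.refl ≡.refl)
splits⇒interleaving (suc j) {x ∷ xs} vr∈ with ∈-++⁻ (List.map (map₁ (x ∷_)) (splits j xs)) vr∈
... | inj₁ ∈l with _ , m , ≡.refl ← ∈-map⁻ (map₁ (x ∷_)) ∈l = consˡ (splits⇒interleaving j m)
... | inj₂ ∈r with _ , m , ≡.refl ← ∈-map⁻ (map₂ (x ∷_)) ∈r = consʳ (splits⇒interleaving (suc j) m)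

interleaving⇒splits : ∀ {xs r} (v : Vec X j) → Interleaving (toList v) r xs → (v , r) ∈ splits j xs
interleaving⇒splits []      i         = here (≡.cong ([] ,_) (unique i))
  where
  unique : ∀ {r xs} → Interleaving [] r xs → r ≡ xs
  unique []        = ≡.refl
  unique (consʳ i) = ≡.cong (_ ∷_) (unique i)
interleaving⇒splits (x ∷ v) (consˡ i) = ∈-++⁺ˡ (∈-map⁺ _ (interleaving⇒splits v i))
interleaving⇒splits (x ∷ v) (consʳ i) = ∈-++⁺ʳ _ (∈-map⁺ _ (interleaving⇒splits (x ∷ v) i))

-- Strictly increasing, so that the members are distinct as well.
Sorted : List ℕ → Set
Sorted = AllPairs _<_

module _ {P : X → Set p} where
  All-interleaving : ∀ {l r xs} → Interleaving l r xs → All P xs → All P l × All P r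
  All-interleaving []        []         = [] , []
  All-interleaving (consˡ i) (px ∷ pxs) = map₁ (px ∷_) (All-interleaving i pxs)
  All-interleaving (consʳ i) (px ∷ pxs) = map₂ (px ∷_) (All-interleaving i pxs)

Sorted-interleaving : ∀ {l r L} → Interleaving l r L → Sorted L → Sorted l × Sorted r
Sorted-interleaving []        []         = [] , []
Sorted-interleaving (consˡ i) (px ∷ pxs) =
  map₁ (proj₁ (All-interleaving i px) ∷_) (Sorted-interleaving i pxs)
Sorted-interleaving (consʳ i) (px ∷ pxs) =
  map₂ (proj₂ (All-interleaving i px) ∷_) (Sorted-interleaving i pxs)

splits-sorted : ∀ j {L v r} → Sorted L → (v , r) ∈ splits j L → Sorted (toList v) × Sorted r
splits-sorted j s m = Sorted-interleaving (splits⇒interleaving j m) s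

splits-length : ∀ j {xs : List X} {v r} → (v , r) ∈ splits j xs → length xs ≡ j ℕ.+ length r
splits-length j {xs} {v} {r} m = begin
  length xs                    ≡⟨ ↭-length (toPermutation (splits⇒interleaving j m)) ⟩
  length (toList v ++ r)       ≡⟨ List.length-++ (toList v) ⟩
  length (toList v) ℕ.+ length r ≡⟨ ≡.cong (ℕ._+ length r) (Vec.length-toList v) ⟩
  j ℕ.+ length r                 ∎
  where open ≡.≡-Reasoning

sorted⇒linked : (v : Vec ℕ n) → Sorted (toList v) → Linked _<_ v
sorted⇒linked []          _             = []
sorted⇒linked (x ∷ [])    _             = [-]
sorted⇒linked (x ∷ y ∷ v) ((p ∷ _) ∷ s) = p ∷ sorted⇒linked (y ∷ v) s

linked⇒sorted : {v : Vec ℕ n} → Linked _<_ v → Sorted (toList v)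
linked⇒sorted []  = []
linked⇒sorted [-] = [] ∷ []
linked⇒sorted {v = _ ∷ _ ∷ _} (p ∷ l) with linked⇒sorted l
... | s@(q ∷ _) = (p ∷ All.map (ℕ.<-trans p) q) ∷ s

-- A sorted list l of members of a sorted list L is a subsequence of it, and
-- the other members are listed by r in increasing order.
sorted-complement : ∀ {l R L} → Sorted l → Sorted L → l ++ R ↭ L →
                    ∃ λ r → Interleaving l r L × r ↭ R
sorted-complement {l} {R} {[]} _ _ perm with ≡.refl ← List.++-conicalˡ l R (↭-empty-inv perm) =
  [] , [] , ↭-sym perm
sorted-complement {[]} {R} {x ∷ L} _ _ perm = x ∷ L , right (Pointwise.refl ≡.refl) , ↭-sym perm
sorted-complement {b ∷ l} {R} {x ∷ L} sl@(b<l ∷ sl′) (x<L ∷ sL) perm with x ℕ.≟ b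
... | yes ≡.refl =
  let r , i , eq = sorted-complement sl′ sL (drop-∷ perm) in r , consˡ i , eq
... | no x≢b with ∈-++⁻ (b ∷ l) (∈-resp-↭ (↭-sym perm) (here ≡.refl))
...   | inj₁ (here x≡b)  = contradiction x≡b x≢b
...   | inj₁ (there x∈l) with ∈-resp-↭ perm (here ≡.refl)
...     | here b≡x  = contradiction (≡.sym b≡x) x≢b
...     | there b∈L = contradiction (All.lookup b<l x∈l) (ℕ.<-asym (All.lookup x<L b∈L))
sorted-complement {b ∷ l} {R} {x ∷ L} sl (x<L ∷ sL) perm | no x≢b | inj₂ x∈R
  with R₁ , R₂ , ≡.refl ← ∈-∃++ x∈R =
  let R′         = R₁ ++ R₂
      R↭         = Perm.shift x R₁ R₂
      perm′      = ↭-trans (↭-sym (Perm.shift x (b ∷ l) R′)) (↭-trans (++⁺ˡ (b ∷ l) (↭-sym R↭)) perm)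
      r , i , eq = sorted-complement sl sL (drop-∷ perm′)
  in x ∷ r , consʳ i , ↭-trans (Perm.prep x eq) (↭-sym R↭)

entries-∷ : (c : Vec ℕ k) (F : Array k n) → entries (c ∷ F) ≡ toList c ++ entries F
entries-∷ c F = Vec.toList-++ c (Vec.concat F)

fillings-∷⁻ : ∀ {L} {F : Array k (suc n)} → F ∈ fillings (suc n) L →
              ∃ λ c → ∃ λ F′ → ∃ λ r → F ≡ c ∷ F′ × (c , r) ∈ splits k L × F′ ∈ fillings n r
fillings-∷⁻ {k} {n} {L} {F} F∈
  with (c , r) , cr∈ , F∈′ ← find
    (∈-concatMap⁻ (λ (c , r) → List.map (c ∷_) (fillings n r)) {xs = splits k L} F∈)
  with F′ , F′∈ , ≡.refl ← ∈-map⁻ (c ∷_) F∈′ = c , F′ , r , ≡.refl , cr∈ , F′∈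

fillings⁻ : ∀ n {L} {F : Array k n} → Sorted L → length L ≡ k ℕ.* n → F ∈ fillings n L →
            entries F ↭ L × VecAll.All (Linked _<_) F
fillings⁻ {k} zero    {[]}    _ _   (here ≡.refl) = ↭-refl , []
fillings⁻ {k} zero    {_ ∷ _} _ len (here ≡.refl) with () ← ≡.trans len (ℕ.*-zeroʳ k)
fillings⁻ {k} (suc n) {L} sL len F∈
  with c , F′ , r , ≡.refl , cr∈ , F′∈ ← fillings-∷⁻ F∈ =
  let i        = splits⇒interleaving k cr∈
      sc , sr  = Sorted-interleaving i sL
      len′     = ℕ.+-cancelˡ-≡ k _ _ (≡.trans (≡.sym (splits-length k cr∈)) (≡.trans len (ℕ.*-suc k n)))
      perm , l = fillings⁻ n sr len′ F′∈
  in ↭-trans (↭-reflexive (entries-∷ c F′)) (↭-trans (++⁺ˡ (toList c) perm) (↭-sym (toPermutation i)))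
     , sorted⇒linked c sc ∷ l

fillings⁺ : ∀ {L} {F : Array k n} → Sorted L → entries F ↭ L → VecAll.All (Linked _<_) F →
            F ∈ fillings n L
fillings⁺ {F = []} _ _ _ = here ≡.refl
fillings⁺ {k = k} {n = suc n} {L = L} {F = c ∷ F} sL perm (l ∷ ls) =
  let r , i , r↭ = sorted-complement (linked⇒sorted l) sL
                     (↭-trans (↭-reflexive (≡.sym (entries-∷ c F))) perm)
  in ∈-concatMap⁺ (λ (c , r) → List.map (c ∷_) (fillings n r)) {xs = splits k L}
       (lose (interleaving⇒splits c i)
         (∈-map⁺ (c ∷_) (fillings⁺ (proj₂ (Sorted-interleaving i sL)) (↭-sym r↭) ls)))

-- A splitting of a list with distinct members is determined by its left part.
splits-distinct : ∀ j {xs : List X} → Unique xs →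
                  AllPairs (λ p q → proj₁ p ≢ proj₁ q) (splits j xs)
splits-distinct zero    _ = [] ∷ []
splits-distinct (suc j) [] = []
splits-distinct (suc j) {x ∷ xs} (x∉xs ∷ u) = AllPairs.++⁺
  (AllPairs.map⁺ (AllPairs.map (λ ne eq → ne (Vec.∷-injectiveʳ eq)) (splits-distinct j u)))
  (AllPairs.map⁺ (AllPairs.map id (splits-distinct (suc j) u)))
  (All.map⁺ (All.tabulate λ _ → All.map⁺ (All.tabulate λ q∈ eq → head≢ (≡.sym eq) q∈)))
  where
  head≢ : ∀ {w : Vec _ j} {v : Vec _ (suc j)} {r} → v ≡ x ∷ w → (v , r) ∉ splits (suc j) xs
  head≢ ≡.refl q∈ with (x≢x ∷ _) , _ ← All-interleaving (splits⇒interleaving (suc j) q∈) x∉xs =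
    x≢x ≡.refl

fillings-unique : ∀ n {L} → Sorted L → Unique (fillings {k} n L)
fillings-unique     zero    _      = [] ∷ []
fillings-unique {k} (suc n) {L} sL = Unique.concat⁺
  (All.map⁺ (All.tabulate λ cr∈ →
    Unique.map⁺ Vec.∷-injectiveʳ (fillings-unique n (proj₂ (splits-sorted k sL cr∈)))))
  (AllPairs.map⁺ (AllPairs.map disjoint (splits-distinct k (AllPairs.map ℕ.<⇒≢ sL))))
  where
  disjoint : ∀ {p q : Vec ℕ k × List ℕ} → proj₁ p ≢ proj₁ q → ∀ {F} →
             F ∈ List.map (proj₁ p ∷_) (fillings n (proj₂ p)) ×
             F ∈ List.map (proj₁ q ∷_) (fillings n (proj₂ q)) → _
  disjoint ne (∈p , ∈q) with _ , _ , ≡.refl ← ∈-map⁻ _ ∈p | _ , _ , eq ← ∈-map⁻ _ ∈q =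
    ne (Vec.∷-injectiveˡ eq)

[1⋯]-sorted : ∀ n → Sorted [1⋯ n ]
[1⋯]-sorted n = AllPairs.map⁺ (AllPairs.applyUpTo⁺₁ id n (λ i<j _ → s<s i<j))

length-[1⋯] : ∀ n → length [1⋯ n ] ≡ n
length-[1⋯] n = ≡.trans (List.length-map suc (upTo n)) (List.length-upTo n)

unique⇒↭ : {xs ys : List X} → Unique xs → Unique ys →
           (∀ {x} → x ∈ xs → x ∈ ys) → (∀ {x} → x ∈ ys → x ∈ xs) → xs ↭ ys
unique⇒↭ u v to from = ∼bag⇒↭ (Membership.unique∧set⇒bag u v (mk⇔ to from))

𝓕↭fillings : ∀ n k → 𝓕 n k ↭ fillings n [1⋯ k ℕ.* n ]
𝓕↭fillings n k = unique⇒↭ (𝓕-unique n k) (fillings-unique n sorted) to from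
  where
  sorted : Sorted [1⋯ k ℕ.* n ]
  sorted = [1⋯]-sorted (k ℕ.* n)

  to : ∀ {F} → F ∈ 𝓕 n k → F ∈ fillings n [1⋯ k ℕ.* n ]
  to F∈ with perm , l ← ∈-𝓕⁻ F∈ = fillings⁺ sorted perm l

  from : ∀ {F} → F ∈ fillings n [1⋯ k ℕ.* n ] → F ∈ 𝓕 n k
  from F∈ = ∈-𝓕⁺ (fillings⁻ n sorted (length-[1⋯] (k ℕ.* n)) F∈)

------------------------------------------------------------------------
-- Order-preserving relabellings

-- The members of L, followed by the consecutive numbers from the successor of
-- the last member on, or from b on if L is empty.  If L is sorted, this is a
-- strictly increasing function that maps 0, 1, ... to the members of L; it is defined
-- on all of ℕ, so that order invariance need only be required for such functions.
enumerate : ℕ → List ℕ → ℕ → ℕ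
enumerate b []      i       = b ℕ.+ i
enumerate b (x ∷ L) zero    = x
enumerate b (x ∷ L) (suc i) = enumerate (suc x) L i

enumerate-lower : ∀ {b L} i → All (b ≤_) L → Sorted L → b ≤ enumerate b L i
enumerate-lower {b} i       []        []        = ℕ.m≤m+n b i
enumerate-lower     zero    (b≤x ∷ _) _         = b≤x
enumerate-lower     (suc i) (b≤x ∷ _) (x<L ∷ s) =
  ℕ.≤-trans (ℕ.m≤n⇒m≤1+n b≤x) (enumerate-lower i x<L s)

enumerate-mono : ∀ {b L} → Sorted L → ∀ {i j} → i < j → enumerate b L i < enumerate b L j
enumerate-mono {b} []        i<j               = ℕ.+-monoʳ-< b i<j
enumerate-mono     (x<L ∷ s) {zero}  {suc j} _ = enumerate-lower j x<L s
enumerate-mono     (x<L ∷ s) {suc i} (s<s i<j) = enumerate-mono s i<j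

map-enumerate : ∀ b L → List.map (enumerate b L) (upTo (length L)) ≡ L
map-enumerate b L = ≡.trans (List.map-upTo (enumerate b L) (length L)) (applyUpTo-enumerate b L)
  where
  applyUpTo-enumerate : ∀ b L → List.applyUpTo (enumerate b L) (length L) ≡ L
  applyUpTo-enumerate b []      = ≡.refl
  applyUpTo-enumerate b (x ∷ L) = ≡.cong (x ∷_) (applyUpTo-enumerate (suc x) L)

-- The rank of an entry is preserved by order-preserving relabellings.
count-map : ∀ {σ : ℕ → ℕ} → σ Preserves _<_ ⟶ _<_ → ∀ e (w : Vec ℕ n) →
            count (ℕ._≤? σ e) (Vec.map σ w) ≡ count (ℕ._≤? e) w
count-map σ-mono e []      = ≡.refl
count-map {σ = σ} σ-mono e (a ∷ w) = ≡.trans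
  (≡.cong (λ b → (if b then suc else id) _) (does-⇔ (mk⇔ from to) (σ a ℕ.≤? σ e) (a ℕ.≤? e)))
  (≡.cong (if does (a ℕ.≤? e) then suc else id) (count-map σ-mono e w))
  where
  from : σ a ≤ σ e → a ≤ e
  from σa≤σe = ℕ.≮⇒≥ λ e<a → ℕ.<-irrefl ≡.refl (ℕ.<-≤-trans (σ-mono e<a) σa≤σe)

  to : a ≤ e → σ a ≤ σ e
  to a≤e with ℕ.m≤n⇒m<n∨m≡n a≤e
  ... | inj₁ a<e    = ℕ.<⇒≤ (σ-mono a<e)
  ... | inj₂ ≡.refl = ℕ.≤-refl

red-map : ∀ {σ : ℕ → ℕ} → σ Preserves _<_ ⟶ _<_ → (F : Array k n) →
          red (Vec.map (Vec.map σ) F) ≡ red F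
red-map {σ = σ} σ-mono F = begin
  Vec.map (Vec.map rank′) (Vec.map (Vec.map σ) F)    ≡⟨ Vec.map-∘ (Vec.map rank′) (Vec.map σ) F ⟨
  Vec.map (Vec.map rank′ ∘ Vec.map σ) F              ≡⟨ Vec.map-cong (λ c → ≡.sym (Vec.map-∘ rank′ σ c)) F ⟩
  Vec.map (Vec.map (rank′ ∘ σ)) F                    ≡⟨ Vec.map-cong (Vec.map-cong same-rank) F ⟩
  red F                                              ∎
  where
  open ≡.≡-Reasoning
  rank′ : ℕ → ℕ
  rank′ e = count (ℕ._≤? e) (concat (Vec.map (Vec.map σ) F))

  same-rank : ∀ e → rank′ (σ e) ≡ count (ℕ._≤? e) (concat F)
  same-rank e = ≡.trans (≡.cong (count (ℕ._≤? σ e)) (≡.sym (Vec.map-concat σ F)))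
                        (count-map σ-mono e (concat F))

------------------------------------------------------------------------
-- Sums over splittings and fillings

module ListSum {c ℓ : Level} (R : CommutativeRing c ℓ) where
  open CommutativeRing R hiding (zero)
  open SemiringSolver commutativeSemiring using (solve; _:=_; _:+_)
  open Sum semiring using (sum; ∑-distrib-+; sum-replicate-zero)
  open Mult semiring using (×-homo-+) renaming (_×_ to _·_)
  open ≈-Reasoning setoid

  ∑ : List X → (X → Carrier) → Carrier
  ∑ xs f = List.foldr (λ x s → f x + s) 0# xs

  ∑-cong : ∀ {f g : X → Carrier} xs → (∀ {x} → x ∈ xs → f x ≈ g x) → ∑ xs f ≈ ∑ xs g
  ∑-cong []       _  = refl
  ∑-cong (x ∷ xs) eq = +-cong (eq (here ≡.refl)) (∑-cong xs (eq ∘ there))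

  ∑-++ : ∀ (f : X → Carrier) xs ys → ∑ (xs ++ ys) f ≈ ∑ xs f + ∑ ys f
  ∑-++ f []       ys = sym (+-identityˡ _)
  ∑-++ f (x ∷ xs) ys = trans (+-congˡ (∑-++ f xs ys)) (sym (+-assoc _ _ _))

  ∑-map : ∀ (g : X → Y) (f : Y → Carrier) xs → ∑ (List.map g xs) f ≈ ∑ xs (f ∘ g)
  ∑-map g f []       = refl
  ∑-map g f (x ∷ xs) = +-congˡ (∑-map g f xs)

  ∑-concatMap : ∀ (g : X → List Y) (f : Y → Carrier) xs →
                ∑ (concatMap g xs) f ≈ ∑ xs (λ x → ∑ (g x) f)
  ∑-concatMap g f []       = refl
  ∑-concatMap g f (x ∷ xs) = trans (∑-++ f (g x) (concatMap g xs)) (+-congˡ (∑-concatMap g f xs))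

  ∑-zero : ∀ (xs : List X) → ∑ xs (λ _ → 0#) ≈ 0#
  ∑-zero []       = refl
  ∑-zero (x ∷ xs) = trans (+-identityˡ _) (∑-zero xs)

  ∑-+ : ∀ (f g : X → Carrier) xs → ∑ xs (λ x → f x + g x) ≈ ∑ xs f + ∑ xs g
  ∑-+ f g []       = sym (+-identityˡ 0#)
  ∑-+ f g (x ∷ xs) = trans (+-congˡ (∑-+ f g xs))
    (solve 4 (λ a b c d → a :+ b :+ (c :+ d) := a :+ c :+ (b :+ d)) refl _ _ _ _)

  ∑-*ˡ : ∀ b (f : X → Carrier) xs → ∑ xs (λ x → b * f x) ≈ b * ∑ xs f
  ∑-*ˡ b f []       = sym (zeroʳ b)
  ∑-*ˡ b f (x ∷ xs) = trans (+-congˡ (∑-*ˡ b f xs)) (sym (distribˡ _ _ _))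

  ∑-*ʳ : ∀ b (f : X → Carrier) xs → ∑ xs (λ x → f x * b) ≈ ∑ xs f * b
  ∑-*ʳ b f []       = sym (zeroˡ b)
  ∑-*ʳ b f (x ∷ xs) = trans (+-congˡ (∑-*ʳ b f xs)) (sym (distribʳ _ _ _))

  ∑-↭ : ∀ (f : X → Carrier) {xs ys} → xs ↭ ys → ∑ xs f ≈ ∑ ys f
  ∑-↭ f Perm.refl         = refl
  ∑-↭ f (Perm.prep x p)   = +-congˡ (∑-↭ f p)
  ∑-↭ f (Perm.swap x y p) = trans (+-congˡ (+-congˡ (∑-↭ f p)))
    (solve 3 (λ a b c → a :+ (b :+ c) := b :+ (a :+ c)) refl _ _ _)
  ∑-↭ f (Perm.trans p q)  = trans (∑-↭ f p) (∑-↭ f q)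

  ∑-filter : ∀ {P : Pred X p} (P? : Decidable P) xs →
    length (List.filter P? xs) · 1# ≈ ∑ xs (λ x → if does (P? x) then 1# else 0#)
  ∑-filter P? []       = refl
  ∑-filter P? (x ∷ xs) with does (P? x)
  ... | true  = +-congˡ (∑-filter P? xs)
  ... | false = trans (∑-filter P? xs) (sym (+-identityˡ _))

  ∑-sum : ∀ (f : X → Fin n → Carrier) xs →
          ∑ xs (λ x → sum (f x)) ≈ sum (λ i → ∑ xs (λ x → f x i))
  ∑-sum {n = n} f []       = sym (sum-replicate-zero n)
  ∑-sum f (x ∷ xs) = trans (+-congˡ (∑-sum f xs)) (sym (∑-distrib-+ (f x) _))

  -- The sum over the splittings of a list with left part of length j.
  ∑ˢ : ∀ j → List X → (Vec X j → List X → Carrier) → Carrier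
  ∑ˢ j xs φ = ∑ (splits j xs) (uncurry φ)

  ∑ˢ-∷ : ∀ j (x : X) xs φ → ∑ˢ (suc j) (x ∷ xs) φ ≈
         ∑ˢ j xs (λ l r → φ (x ∷ l) r) + ∑ˢ (suc j) xs (λ l r → φ l (x ∷ r))
  ∑ˢ-∷ j x xs φ = trans (∑-++ (uncurry φ) (List.map _ (splits j xs)) _)
    (+-cong (∑-map _ (uncurry φ) (splits j xs)) (∑-map _ (uncurry φ) (splits (suc j) xs)))

  ∑ˢ-cong : ∀ j (xs : List X) {φ ψ : Vec X j → List X → Carrier} →
            (∀ {l r} → (l , r) ∈ splits j xs → φ l r ≈ ψ l r) → ∑ˢ j xs φ ≈ ∑ˢ j xs ψ
  ∑ˢ-cong j xs eq = ∑-cong (splits j xs) eq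

  ∑ˢ-resp-≡ : i ≡ j → (xs : List X) (φ : List X → List X → Carrier) →
              ∑ˢ i xs (λ l r → φ (toList l) r) ≈ ∑ˢ j xs (λ l r → φ (toList l) r)
  ∑ˢ-resp-≡ ≡.refl xs φ = refl

  ∑ˢ-+ : ∀ j (xs : List X) (φ ψ : Vec X j → List X → Carrier) →
         ∑ˢ j xs (λ l r → φ l r + ψ l r) ≈ ∑ˢ j xs φ + ∑ˢ j xs ψ
  ∑ˢ-+ j xs φ ψ = ∑-+ (uncurry φ) (uncurry ψ) (splits j xs)

  ∑ˢ-overlong : i ≤ j → (v : Vec X i) (φ : Vec X (suc j) → List X → Carrier) →
                ∑ˢ (suc j) (toList v) φ ≈ 0#
  ∑ˢ-overlong le       []      φ = refl
  ∑ˢ-overlong (s≤s le) (x ∷ v) φ = begin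
    ∑ˢ (suc (suc _)) (x ∷ toList v) φ ≈⟨ ∑ˢ-∷ _ x (toList v) φ ⟩
    _ + _                             ≈⟨ +-cong (∑ˢ-overlong le v _) (∑ˢ-overlong (ℕ.m≤n⇒m≤1+n le) v _) ⟩
    0# + 0#                           ≈⟨ +-identityˡ 0# ⟩
    0#                                ∎

  -- Splitting off j members and then i of the rest amounts to splitting
  -- off j + i members and then j of these.
  ∑ˢ-assoc : ∀ j i (xs : List X) (φ : Vec X j → List X → List X → Carrier) →
    ∑ˢ j xs (λ l r → ∑ˢ i r λ m s → φ l (toList m) s) ≈
    ∑ˢ (j ℕ.+ i) xs (λ u s → ∑ˢ j (toList u) λ l m → φ l m s)
  ∑ˢ-assoc zero i xs φ = trans (+-identityʳ _) (∑ˢ-cong i xs (λ _ → sym (+-identityʳ _)))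
  ∑ˢ-assoc (suc j) i []       φ = refl
  ∑ˢ-assoc (suc j) i (x ∷ xs) φ = begin
    ∑ˢ (suc j) (x ∷ xs) (λ l r → ∑ˢ i r λ m s → φ l (toList m) s)
      ≈⟨ ∑ˢ-∷ j x xs _ ⟩
    ∑ˢ j xs (λ l r → ∑ˢ i r λ m s → φ (x ∷ l) (toList m) s) +
    ∑ˢ (suc j) xs (λ l r → ∑ˢ i (x ∷ r) λ m s → φ l (toList m) s)
      ≈⟨ +-cong (∑ˢ-assoc j i xs (φ ∘ (x ∷_))) (rest i) ⟩
    ∑ˢ (j ℕ.+ i) xs (λ u s → ∑ˢ j (toList u) λ l m → φ (x ∷ l) m s) +
    (∑ˢ (j ℕ.+ i) xs (λ u s → ∑ˢ (suc j) (toList u) λ l m → φ l (x ∷ m) s) +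
     ∑ˢ (suc j ℕ.+ i) xs (λ u s → ∑ˢ (suc j) (toList u) λ l m → φ l m (x ∷ s)))
      ≈⟨ +-assoc _ _ _ ⟨
    ∑ˢ (j ℕ.+ i) xs (λ u s → ∑ˢ j (toList u) λ l m → φ (x ∷ l) m s) +
    ∑ˢ (j ℕ.+ i) xs (λ u s → ∑ˢ (suc j) (toList u) λ l m → φ l (x ∷ m) s) +
    ∑ˢ (suc j ℕ.+ i) xs (λ u s → ∑ˢ (suc j) (toList u) λ l m → φ l m (x ∷ s))
      ≈⟨ +-congʳ (∑ˢ-+ (j ℕ.+ i) xs _ _) ⟨
    ∑ˢ (j ℕ.+ i) xs (λ u s → ∑ˢ j (toList u) (λ l m → φ (x ∷ l) m s) +
                             ∑ˢ (suc j) (toList u) (λ l m → φ l (x ∷ m) s)) +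
    ∑ˢ (suc j ℕ.+ i) xs (λ u s → ∑ˢ (suc j) (toList u) λ l m → φ l m (x ∷ s))
      ≈⟨ +-congʳ (∑ˢ-cong (j ℕ.+ i) xs λ {u} _ → ∑ˢ-∷ j x (toList u) _) ⟨
    ∑ˢ (j ℕ.+ i) xs (λ u s → ∑ˢ (suc j) (x ∷ toList u) λ l m → φ l m s) +
    ∑ˢ (suc j ℕ.+ i) xs (λ u s → ∑ˢ (suc j) (toList u) λ l m → φ l m (x ∷ s))
      ≈⟨ ∑ˢ-∷ (j ℕ.+ i) x xs _ ⟨
    ∑ˢ (suc j ℕ.+ i) (x ∷ xs) (λ u s → ∑ˢ (suc j) (toList u) λ l m → φ l m s) ∎
    where
    -- Here x is a member of the part m or of the part s.
    rest : ∀ i → ∑ˢ (suc j) xs (λ l r → ∑ˢ i (x ∷ r) λ m s → φ l (toList m) s) ≈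
      ∑ˢ (j ℕ.+ i) xs (λ u s → ∑ˢ (suc j) (toList u) λ l m → φ l (x ∷ m) s) +
      ∑ˢ (suc j ℕ.+ i) xs (λ u s → ∑ˢ (suc j) (toList u) λ l m → φ l m (x ∷ s))
    rest zero = begin
      ∑ˢ (suc j) xs (λ l r → φ l [] (x ∷ r) + 0#)
        ≈⟨ ∑ˢ-assoc (suc j) 0 xs (λ l m s → φ l m (x ∷ s)) ⟩
      ∑ˢ (suc j ℕ.+ 0) xs (λ u s → ∑ˢ (suc j) (toList u) λ l m → φ l m (x ∷ s))
        ≈⟨ +-identityˡ _ ⟨
      0# + ∑ˢ (suc j ℕ.+ 0) xs (λ u s → ∑ˢ (suc j) (toList u) λ l m → φ l m (x ∷ s))
        ≈⟨ +-congʳ (trans (∑ˢ-cong (j ℕ.+ 0) xs λ {u} _ →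
             ∑ˢ-overlong (ℕ.≤-reflexive (ℕ.+-identityʳ j)) u _) (∑-zero (splits (j ℕ.+ 0) xs))) ⟨
      ∑ˢ (j ℕ.+ 0) xs (λ u s → ∑ˢ (suc j) (toList u) λ l m → φ l (x ∷ m) s) +
      ∑ˢ (suc j ℕ.+ 0) xs (λ u s → ∑ˢ (suc j) (toList u) λ l m → φ l m (x ∷ s)) ∎
    rest (suc i) = begin
      ∑ˢ (suc j) xs (λ l r → ∑ˢ (suc i) (x ∷ r) λ m s → φ l (toList m) s)
        ≈⟨ ∑ˢ-cong (suc j) xs (λ {_} {r} _ → ∑ˢ-∷ i x r _) ⟩
      ∑ˢ (suc j) xs (λ l r → ∑ˢ i r (λ m s → φ l (x ∷ toList m) s) +
                             ∑ˢ (suc i) r (λ m s → φ l (toList m) (x ∷ s)))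
        ≈⟨ ∑ˢ-+ (suc j) xs _ _ ⟩
      ∑ˢ (suc j) xs (λ l r → ∑ˢ i r λ m s → φ l (x ∷ toList m) s) +
      ∑ˢ (suc j) xs (λ l r → ∑ˢ (suc i) r λ m s → φ l (toList m) (x ∷ s))
        ≈⟨ +-cong (∑ˢ-assoc (suc j) i xs (λ l m s → φ l (x ∷ m) s))
                  (∑ˢ-assoc (suc j) (suc i) xs (λ l m s → φ l m (x ∷ s))) ⟩
      ∑ˢ (suc j ℕ.+ i) xs (λ u s → ∑ˢ (suc j) (toList u) λ l m → φ l (x ∷ m) s) +
      ∑ˢ (suc j ℕ.+ suc i) xs (λ u s → ∑ˢ (suc j) (toList u) λ l m → φ l m (x ∷ s))
        ≈⟨ +-congʳ (∑ˢ-resp-≡ (≡.sym (ℕ.+-suc j i)) xs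
             (λ u s → ∑ˢ (suc j) u λ l m → φ l (x ∷ m) s)) ⟩
      ∑ˢ (j ℕ.+ suc i) xs (λ u s → ∑ˢ (suc j) (toList u) λ l m → φ l (x ∷ m) s) +
      ∑ˢ (suc j ℕ.+ suc i) xs (λ u s → ∑ˢ (suc j) (toList u) λ l m → φ l m (x ∷ s)) ∎

  ∑ˢ-const : ∀ j (xs : List X) b → ∑ˢ j xs (λ _ _ → b) ≈ (length xs C j) · b
  ∑ˢ-const zero    xs       b = refl
  ∑ˢ-const (suc j) []       b = refl
  ∑ˢ-const (suc j) (x ∷ xs) b = begin
    ∑ˢ (suc j) (x ∷ xs) (λ _ _ → b)                     ≈⟨ ∑ˢ-∷ j x xs _ ⟩
    ∑ˢ j xs (λ _ _ → b) + ∑ˢ (suc j) xs (λ _ _ → b)     ≈⟨ +-cong (∑ˢ-const j xs b) (∑ˢ-const (suc j) xs b) ⟩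
    (length xs C j) · b + (length xs C suc j) · b       ≈⟨ ×-homo-+ b (length xs C j) _ ⟨
    (length xs C j ℕ.+ length xs C suc j) · b
      ≈⟨ reflexive (≡.cong (_· b) (nCk+nC[k+1]≡[n+1]C[k+1] (length xs) j)) ⟩
    (suc (length xs) C suc j) · b                       ∎

  ∑ˢ-map : ∀ j (g : X → Y) xs (φ : Vec Y j → List Y → Carrier) →
           ∑ˢ j (List.map g xs) φ ≈ ∑ˢ j xs (λ l r → φ (Vec.map g l) (List.map g r))
  ∑ˢ-map zero    g xs       φ = refl
  ∑ˢ-map (suc j) g []       φ = refl
  ∑ˢ-map (suc j) g (x ∷ xs) φ = begin
    ∑ˢ (suc j) (g x ∷ List.map g xs) φ                  ≈⟨ ∑ˢ-∷ j (g x) _ φ ⟩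
    _ + _                                               ≈⟨ +-cong (∑ˢ-map j g xs _) (∑ˢ-map (suc j) g xs _) ⟩
    _ + _                                               ≈⟨ ∑ˢ-∷ j x xs _ ⟨
    ∑ˢ (suc j) (x ∷ xs) (λ l r → φ (Vec.map g l) (List.map g r)) ∎

  ∑-fillings-suc : ∀ n L (f : Array k (suc n) → Carrier) →
    ∑ (fillings (suc n) L) f ≈ ∑ˢ k L (λ c r → ∑ (fillings n r) λ F → f (c ∷ F))
  ∑-fillings-suc {k} n L f = trans (∑-concatMap _ f (splits k L))
    (∑ˢ-cong k L λ {c} {r} _ → ∑-map (c ∷_) f (fillings n r))

  ∑-fillings-map : ∀ n (σ : ℕ → ℕ) L (f : Array k n → Carrier) →
    ∑ (fillings n (List.map σ L)) f ≈ ∑ (fillings n L) (f ∘ Vec.map (Vec.map σ))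
  ∑-fillings-map zero    σ L f = refl
  ∑-fillings-map {k} (suc n) σ L f = begin
    ∑ (fillings (suc n) (List.map σ L)) f
      ≈⟨ ∑-fillings-suc n _ f ⟩
    ∑ˢ k (List.map σ L) (λ c r → ∑ (fillings n r) λ F → f (c ∷ F))
      ≈⟨ ∑ˢ-map k σ L _ ⟩
    ∑ˢ k L (λ c r → ∑ (fillings n (List.map σ r)) λ F → f (Vec.map σ c ∷ F))
      ≈⟨ ∑ˢ-cong k L (λ {_} {r} _ → ∑-fillings-map n σ r _) ⟩
    ∑ˢ k L (λ c r → ∑ (fillings n r) λ F → f (Vec.map (Vec.map σ) (c ∷ F)))
      ≈⟨ ∑-fillings-suc n L (f ∘ Vec.map (Vec.map σ)) ⟨
    ∑ (fillings (suc n) L) (f ∘ Vec.map (Vec.map σ)) ∎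

------------------------------------------------------------------------
-- Exponential generating functions of weighted arrays

-- Inverses of the factorials, of which a general commutative ring need have none.
record InverseFactorials {c ℓ : Level} (R : CommutativeRing c ℓ) : Set (c ⊔ ℓ) where
  open CommutativeRing R using (Carrier; _≈_; 1#; semiring)
  open Mult semiring using () renaming (_×_ to _·_)
  field
    inv!         : ℕ → Carrier
    inv!-correct : ∀ n → (n !) · inv! n ≈ 1#

module GeneratingFunction {c ℓ : Level} (R : CommutativeRing c ℓ) (inverses : InverseFactorials R)
                          (k : ℕ) where
  open CommutativeRing R hiding (zero)
  open InverseFactorials inverses
  open ListSum R
  open Mult semiring using (×-congʳ; ×-assoc-*; ×-homo-1; ×1-homo-*)
    renaming (_×_ to _·_)
  open PowerSeries rawRing using (constant; indeterminate)
  open PowerSeriesRing R using (commutativeRing; indeterminate-*-suc)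
  open SemiringSolver commutativeSemiring using (solve; _:=_; _:*_)
  open Sum semiring using (sum; sum-cong-≋; *-distribˡ-sum)
  open ≈-Reasoning setoid

  private
    module S = CommutativeRing commutativeRing

  -- An assignment of ring elements to the arrays with k rows; fillings and other
  -- arrays are treated alike.
  Weight : Set c
  Weight = ∀ n → Array k n → Carrier

  -- The value at an array depends only on the relative order of its entries, that
  -- is, strictly increasing relabellings do not change it.
  OrderInvariant : Weight → Set c
  OrderInvariant f = ∀ {σ : ℕ → ℕ} → σ Preserves _<_ ⟶ _<_ →
                     ∀ n F → f n (Vec.map (Vec.map σ) F) ≡ f n F

  -- The sum of a weight over the fillings with the labels L.
  total : Weight → ℕ → List ℕ → Carrier
  total f n L = ∑ (fillings n L) (f n)

  -- The sum of an order-invariant weight depends on the number of labels only: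
  -- every sorted list is the image of 0, ..., m - 1 under a strictly increasing
  -- function.
  total-sorted : ∀ {f} → OrderInvariant f → ∀ n {L m} → Sorted L → length L ≡ m →
                 total f n L ≈ total f n [1⋯ m ]
  total-sorted {f} inv n {L} {m} sL eq =
    trans (canonical sL eq) (sym (canonical ([1⋯]-sorted m) (length-[1⋯] m)))
    where
    canonical : ∀ {L m} → Sorted L → length L ≡ m → total f n L ≈ total f n (upTo m)
    canonical {L} sL ≡.refl = begin
      total f n L
        ≈⟨ reflexive (≡.cong (total f n) (≡.sym (map-enumerate 0 L))) ⟩
      total f n (List.map (enumerate 0 L) (upTo (length L)))
        ≈⟨ ∑-fillings-map n (enumerate 0 L) (upTo (length L)) (f n) ⟩
      ∑ (fillings n (upTo (length L))) (f n ∘ Vec.map (Vec.map (enumerate 0 L)))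
        ≈⟨ ∑-cong (fillings n (upTo (length L))) (λ {F} _ → reflexive (inv (enumerate-mono sL) n F)) ⟩
      total f n (upTo (length L)) ∎

  -- The value of prepend c f at an array is that of f once c is put in front.
  prepend : Vec ℕ k → Weight → Weight
  prepend c f n F = f (suc n) (c ∷ F)

  -- The sum of f F₁ * g F₂ over all ways to cut an array into F₁ and F₂.  The
  -- first summand of the second clause is the cut before the first column.
  infixl 7 _⋆_
  _⋆_ : Weight → Weight → Weight
  (f ⋆ g) zero    []      = f 0 [] * g 0 []
  (f ⋆ g) (suc n) (c ∷ F) = f 0 [] * g (suc n) (c ∷ F) + (prepend c f ⋆ g) n F

  -- The labels are distributed over the i columns of the initial part and the
  -- columns of the final part.
  total-⋆ : ∀ f g n L → total (f ⋆ g) n L ≈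
    sum {suc n} λ i → ∑ˢ (k ℕ.* toℕ i) L λ l r → total f (toℕ i) (toList l) * total g (n ∸ toℕ i) r
  total-⋆ f g n L = go n f L
    where
    part : Weight → ∀ n → List ℕ → ℕ → Carrier
    part f n L i = ∑ˢ (k ℕ.* i) L λ l r → total f i (toList l) * total g (n ∸ i) r

    part-zero : ∀ f n L → f 0 [] * total g n L ≈ part f n L 0
    part-zero f n L = begin
      f 0 [] * total g n L                 ≈⟨ *-congʳ (+-identityʳ _) ⟨
      (f 0 [] + 0#) * total g n L          ≈⟨ +-identityʳ _ ⟨
      (f 0 [] + 0#) * total g n L + 0#
        ≈⟨ ∑ˢ-resp-≡ (≡.sym (ℕ.*-zeroʳ k)) L (λ l r → (f 0 [] + 0#) * total g n r) ⟩
      part f n L 0 ∎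

    part-suc : ∀ f n L i → ∑ˢ k L (λ c r → part (prepend c f) n r i) ≈ part f (suc n) L (suc i)
    part-suc f n L i = begin
      ∑ˢ k L (λ c r → ∑ˢ (k ℕ.* i) r λ l s → total (prepend c f) i (toList l) * total g (n ∸ i) s)
        ≈⟨ ∑ˢ-assoc k (k ℕ.* i) L (λ c l s → total (prepend c f) i l * total g (n ∸ i) s) ⟩
      ∑ˢ (k ℕ.+ k ℕ.* i) L (λ u s → ∑ˢ k (toList u) λ c l → total (prepend c f) i l * total g (n ∸ i) s)
        ≈⟨ ∑ˢ-resp-≡ (≡.sym (ℕ.*-suc k i)) L
             (λ u s → ∑ˢ k u λ c l → total (prepend c f) i l * total g (n ∸ i) s) ⟩
      ∑ˢ (k ℕ.* suc i) L (λ u s → ∑ˢ k (toList u) λ c l → total (prepend c f) i l * total g (n ∸ i) s)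
        ≈⟨ ∑ˢ-cong (k ℕ.* suc i) L (λ {u} {s} _ → trans (∑-*ʳ _ _ (splits k (toList u)))
             (*-congʳ (sym (∑-fillings-suc i (toList u) (f (suc i)))))) ⟩
      part f (suc n) L (suc i) ∎

    go : ∀ n f L → total (f ⋆ g) n L ≈ sum {suc n} (part f n L ∘ toℕ)
    go zero f L = begin
      f 0 [] * g 0 [] + 0#         ≈⟨ +-congʳ (*-congˡ (+-identityʳ _)) ⟨
      f 0 [] * (g 0 [] + 0#) + 0#  ≈⟨ +-congʳ (part-zero f 0 L) ⟩
      part f 0 L 0 + 0#            ∎
    go (suc n) f L = begin
      total (f ⋆ g) (suc n) L
        ≈⟨ ∑-fillings-suc n L ((f ⋆ g) (suc n)) ⟩
      ∑ˢ k L (λ c r → ∑ (fillings n r) λ F →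
        f 0 [] * g (suc n) (c ∷ F) + (prepend c f ⋆ g) n F)
        ≈⟨ ∑ˢ-cong k L (λ {_} {r} _ → ∑-+ _ _ (fillings n r)) ⟩
      ∑ˢ k L (λ c r → ∑ (fillings n r) (λ F → f 0 [] * g (suc n) (c ∷ F)) +
                      total (prepend c f ⋆ g) n r)
        ≈⟨ ∑ˢ-+ k L _ _ ⟩
      ∑ˢ k L (λ c r → ∑ (fillings n r) (λ F → f 0 [] * g (suc n) (c ∷ F))) +
      ∑ˢ k L (λ c r → total (prepend c f ⋆ g) n r)
        ≈⟨ +-cong first later ⟩
      part f (suc n) L 0 + sum {suc n} (part f (suc n) L ∘ suc ∘ toℕ) ∎
      where
      first = begin
        ∑ˢ k L (λ c r → ∑ (fillings n r) (λ F → f 0 [] * g (suc n) (c ∷ F)))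
          ≈⟨ ∑-fillings-suc n L (λ F → f 0 [] * g (suc n) F) ⟨
        ∑ (fillings (suc n) L) (λ F → f 0 [] * g (suc n) F)
          ≈⟨ ∑-*ˡ (f 0 []) (g (suc n)) (fillings (suc n) L) ⟩
        f 0 [] * total g (suc n) L
          ≈⟨ part-zero f (suc n) L ⟩
        part f (suc n) L 0 ∎

      later = begin
        ∑ˢ k L (λ c r → total (prepend c f ⋆ g) n r)
          ≈⟨ ∑ˢ-cong k L (λ {c} {r} _ → go n (prepend c f) r) ⟩
        ∑ˢ k L (λ c r → sum {suc n} (part (prepend c f) n r ∘ toℕ))
          ≈⟨ ∑-sum {n = suc n} (λ (c , r) i → part (prepend c f) n r (toℕ i)) (splits k L) ⟩
        sum {suc n} (λ i → ∑ˢ k L (λ c r → part (prepend c f) n r (toℕ i)))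
          ≈⟨ sum-cong-≋ {suc n} (λ i → part-suc f n L (toℕ i)) ⟩
        sum {suc n} (part f (suc n) L ∘ suc ∘ toℕ) ∎

  ·-as-* : ∀ m b → m · b ≈ (m · 1#) * b
  ·-as-* m b = sym (trans (×-assoc-* m 1# b) (×-congʳ m (*-identityˡ b)))

  binomial-factorial : ∀ {j n} → j ≤ n → (n C j) ℕ.* (j ! ℕ.* (n ∸ j) !) ≡ n !
  binomial-factorial {j} {n} j≤n = ≡.trans
    (≡.cong (ℕ._* (j ! ℕ.* (n ∸ j) !)) (nCk≡n!/k![n-k]! j≤n))
    (m/n*n≡m (≡.subst (ℕ._∣ n !) (ℕ.*-comm ((n ∸ j) !) (j !)) ([n∸k]!k!∣n! j≤n)))
    where
    instance _ = j ℕ.!* (n ∸ j) !≢0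

  inv!-binomial : ∀ {j n} → j ≤ n → ∀ b → inv! n * ((n C j) · b) ≈ inv! j * inv! (n ∸ j) * b
  inv!-binomial {j} {n} j≤n b = begin
    inv! n * (C′ · b)
      ≈⟨ *-congˡ (·-as-* C′ b) ⟩
    inv! n * (C′ · 1# * b)
      ≈⟨ trans (*-identityˡ _) (*-identityˡ _) ⟨
    1# * (1# * (inv! n * (C′ · 1# * b)))
      ≈⟨ *-cong (inv!-correct j) (*-congʳ (inv!-correct (n ∸ j))) ⟨
    (j !) · inv! j * (((n ∸ j) !) · inv! (n ∸ j) * (inv! n * (C′ · 1# * b)))
      ≈⟨ *-cong (·-as-* (j !) _) (*-congʳ (·-as-* ((n ∸ j) !) _)) ⟩
    (j !) · 1# * inv! j * (((n ∸ j) !) · 1# * inv! (n ∸ j) * (inv! n * (C′ · 1# * b)))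
      ≈⟨ solve 7 (λ x y z p q r b → x :* p :* (y :* q :* (r :* (z :* b))) :=
                                    z :* (x :* y) :* r :* (p :* q :* b)) refl
           ((j !) · 1#) (((n ∸ j) !) · 1#) (C′ · 1#) (inv! j) (inv! (n ∸ j)) (inv! n) b ⟩
    C′ · 1# * ((j !) · 1# * ((n ∸ j) !) · 1#) * inv! n * (inv! j * inv! (n ∸ j) * b)
      ≈⟨ *-congʳ factorials ⟩
    1# * (inv! j * inv! (n ∸ j) * b)
      ≈⟨ *-identityˡ _ ⟩
    inv! j * inv! (n ∸ j) * b ∎
    where
    C′ = n C j

    factorials = begin
      C′ · 1# * ((j !) · 1# * ((n ∸ j) !) · 1#) * inv! n
        ≈⟨ *-congʳ (*-congˡ (×1-homo-* (j !) ((n ∸ j) !))) ⟨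
      C′ · 1# * (j ! ℕ.* (n ∸ j) !) · 1# * inv! n
        ≈⟨ *-congʳ (×1-homo-* C′ (j ! ℕ.* (n ∸ j) !)) ⟨
      (C′ ℕ.* (j ! ℕ.* (n ∸ j) !)) · 1# * inv! n
        ≈⟨ ·-as-* (C′ ℕ.* (j ! ℕ.* (n ∸ j) !)) (inv! n) ⟨
      (C′ ℕ.* (j ! ℕ.* (n ∸ j) !)) · inv! n
        ≈⟨ reflexive (≡.cong (_· inv! n) (binomial-factorial j≤n)) ⟩
      (n !) · inv! n
        ≈⟨ inv!-correct n ⟩
      1# ∎

  -- The exponential generating function of a weight: its coefficient at n is the
  -- sum over the fillings with k * n labels, divided by the factorial of k * n.
  egf : Weight → S.Carrier
  egf f n = inv! (k ℕ.* n) * total f n [1⋯ k ℕ.* n ]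

  egf-cong : ∀ {f g} → (∀ n F → f n F ≈ g n F) → egf f S.≈ egf g
  egf-cong eq n = *-congˡ (∑-cong (fillings n [1⋯ k ℕ.* n ]) λ {F} _ → eq n F)

  egf-+ : ∀ f g → egf (λ n F → f n F + g n F) S.≈ egf f S.+ egf g
  egf-+ f g n = trans (*-congˡ (∑-+ (f n) (g n) (fillings n [1⋯ k ℕ.* n ]))) (distribˡ _ _ _)

  egf-* : ∀ b f n → egf (λ n F → b * f n F) n ≈ b * egf f n
  egf-* b f n = trans (*-congˡ (∑-*ˡ b (f n) (fillings n [1⋯ k ℕ.* n ])))
    (solve 3 (λ x y z → x :* (y :* z) := y :* (x :* z)) refl _ _ _)

  egf-⋆ : ∀ {f g} → OrderInvariant f → OrderInvariant g → egf (f ⋆ g) S.≈ egf f S.* egf g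
  egf-⋆ {f} {g} f-inv g-inv n = begin
    inv! (k ℕ.* n) * total (f ⋆ g) n L
      ≈⟨ *-congˡ (total-⋆ f g n L) ⟩
    inv! (k ℕ.* n) * sum {suc n} (λ i → ∑ˢ (k ℕ.* toℕ i) L λ l r →
      total f (toℕ i) (toList l) * total g (n ∸ toℕ i) r)
      ≈⟨ *-distribˡ-sum {suc n} (inv! (k ℕ.* n)) (λ i → ∑ˢ (k ℕ.* toℕ i) L λ l r →
           total f (toℕ i) (toList l) * total g (n ∸ toℕ i) r) ⟩
    sum {suc n} (λ i → inv! (k ℕ.* n) * ∑ˢ (k ℕ.* toℕ i) L λ l r →
      total f (toℕ i) (toList l) * total g (n ∸ toℕ i) r)
      ≈⟨ sum-cong-≋ {suc n} (λ i → term (toℕ i) (ℕ.≤-pred (Fin.toℕ<n i))) ⟩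
    sum {suc n} (λ i → egf f (toℕ i) * egf g (n ∸ toℕ i)) ∎
    where
    L = [1⋯ k ℕ.* n ]

    term : ∀ i → i ≤ n → inv! (k ℕ.* n) * ∑ˢ (k ℕ.* i) L (λ l r →
             total f i (toList l) * total g (n ∸ i) r) ≈ egf f i * egf g (n ∸ i)
    term i i≤n = begin
      inv! (k ℕ.* n) * ∑ˢ (k ℕ.* i) L (λ l r → total f i (toList l) * total g (n ∸ i) r)
        ≈⟨ *-congˡ (∑ˢ-cong (k ℕ.* i) L λ {l} {r} lr∈ →
             let sl , sr = splits-sorted (k ℕ.* i) ([1⋯]-sorted (k ℕ.* n)) lr∈ in
             *-cong (total-sorted f-inv i sl (Vec.length-toList l))
                    (total-sorted g-inv (n ∸ i) sr (length-r lr∈))) ⟩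
      inv! (k ℕ.* n) * ∑ˢ (k ℕ.* i) L (λ _ _ → tf * tg)
        ≈⟨ *-congˡ (∑ˢ-const (k ℕ.* i) L (tf * tg)) ⟩
      inv! (k ℕ.* n) * (length L C (k ℕ.* i)) · (tf * tg)
        ≈⟨ *-congˡ (reflexive (≡.cong (λ m → (m C (k ℕ.* i)) · (tf * tg)) (length-[1⋯] (k ℕ.* n)))) ⟩
      inv! (k ℕ.* n) * ((k ℕ.* n) C (k ℕ.* i)) · (tf * tg)
        ≈⟨ inv!-binomial (ℕ.*-monoʳ-≤ k i≤n) (tf * tg) ⟩
      inv! (k ℕ.* i) * inv! (k ℕ.* n ∸ k ℕ.* i) * (tf * tg)
        ≈⟨ *-congʳ (*-congˡ (reflexive (≡.cong inv! (ℕ.*-distribˡ-∸ k n i)))) ⟨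
      inv! (k ℕ.* i) * inv! (k ℕ.* (n ∸ i)) * (tf * tg)
        ≈⟨ solve 4 (λ x y z w → x :* y :* (z :* w) := x :* z :* (y :* w)) refl _ _ _ _ ⟩
      egf f i * egf g (n ∸ i) ∎
      where
      tf = total f i [1⋯ k ℕ.* i ]
      tg = total g (n ∸ i) [1⋯ k ℕ.* (n ∸ i) ]

      length-r : ∀ {l r} → (l , r) ∈ splits (k ℕ.* i) L → length r ≡ k ℕ.* (n ∸ i)
      length-r {r = r} lr∈ = ≡.sym (≡.trans (ℕ.*-distribˡ-∸ k n i)
        (≡.trans (≡.cong (_∸ k ℕ.* i)
                   (≡.trans (≡.sym (length-[1⋯] (k ℕ.* n))) (splits-length (k ℕ.* i) lr∈)))
                 (ℕ.m+n∸m≡n (k ℕ.* i) (length r))))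

  -- The indicators of the arrays without columns and with one column.
  empty : Weight
  empty zero    _ = 1#
  empty (suc _) _ = 0#

  singleColumn : Weight
  singleColumn zero    _       = 0#
  singleColumn (suc n) (_ ∷ F) = empty n F

  empty-invariant : OrderInvariant empty
  empty-invariant σ-mono zero    F = ≡.refl
  empty-invariant σ-mono (suc n) F = ≡.refl

  singleColumn-invariant : OrderInvariant singleColumn
  singleColumn-invariant σ-mono zero    F       = ≡.refl
  singleColumn-invariant σ-mono (suc n) (_ ∷ F) = empty-invariant σ-mono n F

  ⋆-zeroˡ : ∀ g n F → ((λ _ _ → 0#) ⋆ g) n F ≈ 0#
  ⋆-zeroˡ g zero    []      = zeroˡ _
  ⋆-zeroˡ g (suc n) (c ∷ F) = trans (+-cong (zeroˡ _) (⋆-zeroˡ g n F)) (+-identityˡ _)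

  ⋆-identityˡ : ∀ g n F → (empty ⋆ g) n F ≈ g n F
  ⋆-identityˡ g zero    []      = *-identityˡ _
  ⋆-identityˡ g (suc n) (c ∷ F) = trans (+-cong (*-identityˡ _) (⋆-zeroˡ g n F)) (+-identityʳ _)

  -- If f vanishes on the empty array and on the single column u, only the cuts
  -- behind the second column contribute.
  ⋆-∷∷ : ∀ f g u v F → f 0 [] ≈ 0# → f 1 (u ∷ []) ≈ 0# →
         (f ⋆ g) (suc (suc n)) (u ∷ v ∷ F) ≈ (prepend v (prepend u f) ⋆ g) n F
  ⋆-∷∷ f g u v F f₀ f₁ = begin
    f 0 [] * _ + (f 1 (u ∷ []) * _ + rest)
      ≈⟨ +-cong (trans (*-congʳ f₀) (zeroˡ _)) (+-congʳ (trans (*-congʳ f₁) (zeroˡ _))) ⟩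
    0# + (0# + rest)   ≈⟨ trans (+-identityˡ _) (+-identityˡ _) ⟩
    rest               ∎
    where
    rest = (prepend v (prepend u f) ⋆ g) _ F

  inv!-0 : inv! (k ℕ.* 0) ≈ 1#
  inv!-0 = trans (reflexive (≡.cong inv! (ℕ.*-zeroʳ k))) (trans (sym (×-homo-1 _)) (inv!-correct 0))

  egf-zero : ∀ f → egf f 0 ≈ f 0 []
  egf-zero f = trans (*-cong inv!-0 (+-identityʳ _)) (*-identityˡ _)

  egf-vanishing : ∀ f n → (∀ F → f n F ≈ 0#) → egf f n ≈ 0#
  egf-vanishing f n f≈0 = trans
    (*-congˡ (trans (∑-cong {f = f n} (fillings n L) λ {F} _ → f≈0 F) (∑-zero (fillings {k} n L))))
    (zeroʳ _)
    where L = [1⋯ k ℕ.* n ]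

  egf-empty : egf empty S.≈ S.1#
  egf-empty zero    = egf-zero empty
  egf-empty (suc n) = egf-vanishing empty (suc n) λ _ → refl

  egf-singleColumn : egf singleColumn S.≈ indeterminate S.* constant (inv! k)
  egf-singleColumn zero    = trans (egf-zero singleColumn) (sym (trans (+-identityʳ _) (zeroˡ _)))
  egf-singleColumn (suc n) = trans (shifted n) (sym (indeterminate-*-suc (constant (inv! k)) n))
    where
    shifted : ∀ n → egf singleColumn (suc n) ≈ constant (inv! k) n
    shifted zero = begin
      inv! (k ℕ.* 1) * total singleColumn 1 [1⋯ k ℕ.* 1 ]
        ≈⟨ reflexive (≡.cong (λ m → inv! m * total singleColumn 1 [1⋯ m ]) (ℕ.*-identityʳ k)) ⟩
      inv! k * total singleColumn 1 [1⋯ k ]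
        ≈⟨ *-congˡ (∑-fillings-suc 0 [1⋯ k ] (singleColumn 1)) ⟩
      inv! k * ∑ˢ k [1⋯ k ] (λ _ _ → 1# + 0#)
        ≈⟨ *-congˡ (∑ˢ-const k [1⋯ k ] (1# + 0#)) ⟩
      inv! k * (length [1⋯ k ] C k) · (1# + 0#)
        ≈⟨ *-congˡ (reflexive (≡.cong (_· (1# + 0#)) (≡.trans (≡.cong (_C k) (length-[1⋯] k)) (nCn≡1 k)))) ⟩
      inv! k * (1# + 0# + 0#)
        ≈⟨ *-congˡ (trans (+-identityʳ _) (+-identityʳ _)) ⟩
      inv! k * 1#
        ≈⟨ *-identityʳ _ ⟩
      inv! k ∎
    shifted (suc n) = egf-vanishing singleColumn (suc (suc n)) λ { (_ ∷ _) → refl }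

------------------------------------------------------------------------
-- The identity for matches of consecutive columns

-- Statistics of an array for an arbitrary relation between consecutive columns.
module Matches {k : ℕ} (match : Vec ℕ k → Vec ℕ k → Bool) where

  -- The number of matches found when F is read from left to right and the two
  -- columns of each match found are discarded.
  greedy : Array k n → ℕ
  greedy []          = 0
  greedy (u ∷ [])    = 0
  greedy (u ∷ v ∷ F) = if match u v then suc (greedy F) else greedy (v ∷ F)

  matchFree : Array k n → Bool
  matchFree []          = true
  matchFree (u ∷ [])    = true
  matchFree (u ∷ v ∷ F) = if match u v then false else matchFree (v ∷ F)

  -- A further column in front raises the greedy count by at most one.  Each of the
  -- two bounds follows from the other one for one column less if v and w match.
  greedy-tail : ∀ v (F : Array k n) → greedy F ≤ greedy (v ∷ F) × greedy (v ∷ F) ≤ suc (greedy F)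
  greedy-tail v []      = z≤n , z≤n
  greedy-tail v (w ∷ F) with match v w | greedy-tail w F
  ... | true  | lower , upper = upper , s≤s lower
  ... | false | _             = ℕ.≤-refl , ℕ.n≤1+n _

-- The arguments are the relation of two consecutive columns that is counted, which
-- may depend only on the relative order of their entries, and the element x
-- that marks its occurrences.
module MatchIdentity {c ℓ : Level} (R : CommutativeRing c ℓ) (inverses : InverseFactorials R)
  (k : ℕ) (match : Vec ℕ k → Vec ℕ k → Bool)
  (match-invariant : ∀ {σ : ℕ → ℕ} → σ Preserves _<_ ⟶ _<_ →
                     ∀ u v → match (Vec.map σ u) (Vec.map σ v) ≡ match u v)
  (x : CommutativeRing.Carrier R) where

  open CommutativeRing R hiding (zero)
  open GeneratingFunction R inverses k
  open InverseFactorials inverses using (inv!)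
  open Matches match
  open PowerSeries rawRing using (constant; indeterminate)
  open PowerSeriesRing R using (commutativeRing; constant-*; inverse; inverse-correct)
  open RawSemiringDefinitions (RawRing.rawSemiring rawRing) using (_^_)

  private
    module S = CommutativeRing commutativeRing

  -- The indicator of the arrays without matches.
  matchFreeʷ : Weight
  matchFreeʷ n F = if matchFree F then 1# else 0#

  greedyʷ : Weight
  greedyʷ n F = x ^ greedy F

  -- The indicator of the arrays whose first match consists of the last two
  -- columns.
  endsWithFirst : Weight
  endsWithFirst _ []          = 0#
  endsWithFirst _ (u ∷ [])    = 0#
  endsWithFirst _ (u ∷ v ∷ F) = if match u v then empty _ F else endsWithFirst _ (v ∷ F)

  greedy-invariant : ∀ {σ : ℕ → ℕ} → σ Preserves _<_ ⟶ _<_ →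
                     ∀ (F : Array k n) → greedy (Vec.map (Vec.map σ) F) ≡ greedy F
  greedy-invariant σ-mono []          = ≡.refl
  greedy-invariant σ-mono (u ∷ [])    = ≡.refl
  greedy-invariant σ-mono (u ∷ v ∷ F) = ≡.trans (if-cong (match-invariant σ-mono u v))
    (if-cong₂ (match u v) (≡.cong suc (greedy-invariant σ-mono F)) (greedy-invariant σ-mono (v ∷ F)))

  matchFree-invariant : ∀ {σ : ℕ → ℕ} → σ Preserves _<_ ⟶ _<_ →
                        ∀ (F : Array k n) → matchFree (Vec.map (Vec.map σ) F) ≡ matchFree F
  matchFree-invariant σ-mono []          = ≡.refl
  matchFree-invariant σ-mono (u ∷ [])    = ≡.refl
  matchFree-invariant σ-mono (u ∷ v ∷ F) = ≡.trans (if-cong (match-invariant σ-mono u v))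
    (if-cong-else (match u v) (matchFree-invariant σ-mono (v ∷ F)))

  matchFreeʷ-invariant : OrderInvariant matchFreeʷ
  matchFreeʷ-invariant σ-mono n F = if-cong (matchFree-invariant σ-mono F)

  greedyʷ-invariant : OrderInvariant greedyʷ
  greedyʷ-invariant σ-mono n F = ≡.cong (x ^_) (greedy-invariant σ-mono F)

  endsWithFirst-invariant : OrderInvariant endsWithFirst
  endsWithFirst-invariant σ-mono _ []          = ≡.refl
  endsWithFirst-invariant σ-mono _ (u ∷ [])    = ≡.refl
  endsWithFirst-invariant σ-mono (suc (suc n)) (u ∷ v ∷ F) = ≡.trans (if-cong (match-invariant σ-mono u v))
    (if-cong₂ (match u v) (empty-invariant σ-mono n F) (endsWithFirst-invariant σ-mono (suc n) (v ∷ F)))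

  -- Appending a column to a match-free array gives either a match-free nonempty
  -- array or an array whose first match is formed by the last two columns, and all
  -- of these arise in this way.
  endsWithFirst-matchFree : ∀ n F →
    endsWithFirst n F + matchFreeʷ n F ≈ empty n F + (matchFreeʷ ⋆ singleColumn) n F
  endsWithFirst-matchFree _ [] = begin
    0# + 1#      ≈⟨ +-comm _ _ ⟩
    1# + 0#      ≈⟨ +-congˡ (zeroʳ _) ⟨
    1# + 1# * 0# ∎
    where open ≈-Reasoning setoid
  endsWithFirst-matchFree _ (u ∷ []) = +-congˡ (begin
    1#                ≈⟨ +-identityʳ _ ⟨
    1# + 0#           ≈⟨ +-cong (*-identityʳ _) (zeroʳ _) ⟨
    1# * 1# + 1# * 0# ∎)
    where open ≈-Reasoning setoid
  endsWithFirst-matchFree (suc (suc n)) (u ∷ v ∷ F) = begin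
    endsWithFirst _ (u ∷ v ∷ F) + matchFreeʷ _ (u ∷ v ∷ F)
      ≈⟨ cases (endsWithFirst-matchFree (suc n) (v ∷ F)) ⟩
    1# * empty n F + (rest ⋆ singleColumn) n F
      ≈⟨ trans (+-congʳ (zeroʳ _)) (+-identityˡ _) ⟨
    1# * 0# + (1# * empty n F + (rest ⋆ singleColumn) n F)
      ≈⟨ +-identityˡ _ ⟨
    0# + (1# * 0# + (1# * empty n F + (rest ⋆ singleColumn) n F)) ∎
    where
    open ≈-Reasoning setoid
    rest : Weight
    rest = prepend v (prepend u matchFreeʷ)

    cases : endsWithFirst (suc n) (v ∷ F) + matchFreeʷ (suc n) (v ∷ F) ≈
            0# + (matchFreeʷ ⋆ singleColumn) (suc n) (v ∷ F) →
            endsWithFirst (suc (suc n)) (u ∷ v ∷ F) + matchFreeʷ (suc (suc n)) (u ∷ v ∷ F) ≈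
            1# * empty n F + (rest ⋆ singleColumn) n F
    cases ih with match u v
    ... | true  = +-cong (sym (*-identityˡ _)) (sym (⋆-zeroˡ singleColumn n F))
    ... | false = trans ih (+-identityˡ _)

  -- Either there is no match, or there is exactly one initial part that ends with
  -- the first match; the greedy count then counts this match and goes on with the
  -- remaining columns.
  greedy-decomposition : ∀ n F →
    greedyʷ n F ≈ matchFreeʷ n F + x * (endsWithFirst ⋆ greedyʷ) n F
  greedy-decomposition _ [] = begin
    1#                    ≈⟨ +-identityʳ _ ⟨
    1# + 0#               ≈⟨ +-congˡ (trans (*-congˡ (zeroˡ _)) (zeroʳ _)) ⟨
    1# + x * (0# * 1#)    ∎
    where open ≈-Reasoning setoid
  greedy-decomposition _ (u ∷ []) = begin
    1#                              ≈⟨ +-identityʳ _ ⟨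
    1# + 0#                         ≈⟨ +-congˡ 
      (trans (*-congˡ (trans (+-cong (zeroˡ _) (zeroˡ _)) (+-identityˡ _))) (zeroʳ _)) ⟨
    1# + x * (0# * 1# + 0# * 1#)    ∎
    where open ≈-Reasoning setoid
  greedy-decomposition (suc (suc n)) (u ∷ v ∷ F) = begin
    greedyʷ _ (u ∷ v ∷ F)
      ≈⟨ cases (greedy-decomposition (suc n) (v ∷ F)) ⟩
    matchFreeʷ _ (u ∷ v ∷ F) + x * (rest ⋆ greedyʷ) n F
      ≈⟨ +-congˡ (*-congˡ (⋆-∷∷ endsWithFirst greedyʷ u v F refl refl)) ⟨
    matchFreeʷ _ (u ∷ v ∷ F) + x * (endsWithFirst ⋆ greedyʷ) _ (u ∷ v ∷ F) ∎
    where
    open ≈-Reasoning setoid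
    rest : Weight
    rest = prepend v (prepend u endsWithFirst)

    cases : greedyʷ (suc n) (v ∷ F) ≈
            matchFreeʷ (suc n) (v ∷ F) + x * (endsWithFirst ⋆ greedyʷ) (suc n) (v ∷ F) →
            greedyʷ (suc (suc n)) (u ∷ v ∷ F) ≈
            matchFreeʷ (suc (suc n)) (u ∷ v ∷ F) + x * (rest ⋆ greedyʷ) n F
    cases ih with match u v
    ... | true  = trans (*-congˡ (sym (⋆-identityˡ greedyʷ n F))) (sym (+-identityˡ _))
    ... | false = trans ih
      (+-congˡ (*-congˡ (trans (+-congʳ (zeroˡ _)) (+-identityˡ _))))

  -- A and N are any series with the same coefficients as the generating functions.
  -- T is t/k!, and H is the denominator of the quotient.
  module _ {A N : S.Carrier} (A≈ : A S.≈ egf matchFreeʷ) (N≈ : N S.≈ egf greedyʷ) where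
    open ≈-Reasoning S.setoid
    open RingProperties S.ring using (-‿distribˡ-*)
    open AlgebraDefinitions S._≈_ using (Invertible)

    private
      T B x′ H : S.Carrier
      T = indeterminate S.* constant (inv! k)
      B = egf endsWithFirst
      x′ = constant x
      H = S.1# S.+ S.- (x′ S.* (S.1# S.+ (T S.+ S.- S.1#) S.* A))

    endsWithFirst-egf : S.1# S.+ (T S.+ S.- S.1#) S.* A S.≈ B
    endsWithFirst-egf = begin
      S.1# S.+ (T S.+ S.- S.1#) S.* A
        ≈⟨ S.+-congˡ {S.1#} (S.distribʳ A T (S.- S.1#)) ⟩
      S.1# S.+ (T S.* A S.+ (S.- S.1#) S.* A)
        ≈⟨ S.+-congˡ {S.1#} (S.+-cong (S.*-comm T A)
             (S.trans (S.sym (-‿distribˡ-* S.1# A)) (S.-‿cong (S.*-identityˡ A)))) ⟩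
      S.1# S.+ (A S.* T S.+ S.- A)
        ≈⟨ S.+-assoc S.1# (A S.* T) (S.- A) ⟨
      S.1# S.+ A S.* T S.+ S.- A
        ≈⟨ S.+-congʳ {S.- A} step ⟨
      B S.+ A S.+ S.- A
        ≈⟨ S.+-assoc B A (S.- A) ⟩
      B S.+ (A S.+ S.- A)
        ≈⟨ S.+-congˡ {B} (S.-‿inverseʳ A) ⟩
      B S.+ S.0#
        ≈⟨ S.+-identityʳ B ⟩
      B ∎
      where
      step : B S.+ A S.≈ S.1# S.+ A S.* T
      step = begin
        B S.+ A
          ≈⟨ S.+-congˡ {B} A≈ ⟩
        B S.+ egf matchFreeʷ
          ≈⟨ egf-+ endsWithFirst matchFreeʷ ⟨
        egf (λ n F → endsWithFirst n F + matchFreeʷ n F)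
          ≈⟨ egf-cong endsWithFirst-matchFree ⟩
        egf (λ n F → empty n F + (matchFreeʷ ⋆ singleColumn) n F)
          ≈⟨ egf-+ empty (matchFreeʷ ⋆ singleColumn) ⟩
        egf empty S.+ egf (matchFreeʷ ⋆ singleColumn)
          ≈⟨ S.+-cong egf-empty (egf-⋆ matchFreeʷ-invariant singleColumn-invariant) ⟩
        S.1# S.+ egf matchFreeʷ S.* egf singleColumn
          ≈⟨ S.+-congˡ {S.1#} (S.*-cong {egf matchFreeʷ} {A} (S.sym A≈) egf-singleColumn) ⟩
        S.1# S.+ A S.* T ∎

    greedy-egf : N S.≈ A S.+ x′ S.* (B S.* N)
    greedy-egf = begin
      N
        ≈⟨ N≈ ⟩
      egf greedyʷ
        ≈⟨ egf-cong greedy-decomposition ⟩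
      egf (λ n F → matchFreeʷ n F + x * (endsWithFirst ⋆ greedyʷ) n F)
        ≈⟨ egf-+ matchFreeʷ (λ n F → x * (endsWithFirst ⋆ greedyʷ) n F) ⟩
      egf matchFreeʷ S.+ egf (λ n F → x * (endsWithFirst ⋆ greedyʷ) n F)
        ≈⟨ S.+-cong (S.sym A≈) (λ n → trans (egf-* x (endsWithFirst ⋆ greedyʷ) n)
             (sym (constant-* x (egf (endsWithFirst ⋆ greedyʷ)) n))) ⟩
      A S.+ x′ S.* egf (endsWithFirst ⋆ greedyʷ)
        ≈⟨ S.+-congˡ {A} (S.*-congˡ {x′} (egf-⋆ endsWithFirst-invariant greedyʷ-invariant)) ⟩
      A S.+ x′ S.* (B S.* egf greedyʷ)
        ≈⟨ S.+-congˡ {A} (S.*-congˡ {x′} (S.*-congˡ {B} N≈)) ⟨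
      A S.+ x′ S.* (B S.* N) ∎

    denominator : H S.≈ S.1# S.+ S.- (x′ S.* B)
    denominator = S.+-congˡ {S.1#} (S.-‿cong (S.*-congˡ {x′} endsWithFirst-egf))

    denominator-zero : H 0 ≈ 1#
    denominator-zero = trans (denominator 0) (trans (+-congˡ (trans (-‿cong
      (trans (+-identityʳ _) (trans (*-congˡ (egf-zero endsWithFirst)) (zeroʳ _)))) -0#≈0#)) (+-identityʳ _))
      where open RingProperties ring using (-0#≈0#)

    N*H≈A : N S.* H S.≈ A
    N*H≈A = begin
      N S.* H
        ≈⟨ S.*-congˡ {N} denominator ⟩
      N S.* (S.1# S.+ S.- (x′ S.* B))
        ≈⟨ S.*-comm N (S.1# S.+ S.- (x′ S.* B)) ⟩
      (S.1# S.+ S.- (x′ S.* B)) S.* N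
        ≈⟨ S.distribʳ N S.1# (S.- (x′ S.* B)) ⟩
      S.1# S.* N S.+ S.- (x′ S.* B) S.* N
        ≈⟨ S.+-cong (S.*-identityˡ N) 
             (S.trans (S.sym (-‿distribˡ-* (x′ S.* B) N)) (S.-‿cong (S.*-assoc x′ B N))) ⟩
      N S.+ S.- (x′ S.* (B S.* N))
        ≈⟨ S.+-congʳ {S.- (x′ S.* (B S.* N))} greedy-egf ⟩
      A S.+ x′ S.* (B S.* N) S.+ S.- (x′ S.* (B S.* N))
        ≈⟨ S.+-assoc A (x′ S.* (B S.* N)) (S.- (x′ S.* (B S.* N))) ⟩
      A S.+ (x′ S.* (B S.* N) S.+ S.- (x′ S.* (B S.* N)))
        ≈⟨ S.+-congˡ {A} (S.-‿inverseʳ (x′ S.* (B S.* N))) ⟩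
      A S.+ S.0#
        ≈⟨ S.+-identityʳ A ⟩
      A ∎

    quotient : Σ[ (H⁻¹ , _) ∈ Invertible S.1# S._*_ H ] N S.≈ A S.* H⁻¹
    quotient = (inverse H , inverseˡ , inverseʳ) , (begin
      N                        ≈⟨ S.*-identityʳ N ⟨
      N S.* S.1#               ≈⟨ S.*-congˡ {N} inverseʳ ⟨
      N S.* (H S.* inverse H)  ≈⟨ S.*-assoc N H (inverse H) ⟨
      N S.* H S.* inverse H    ≈⟨ S.*-congʳ {inverse H} N*H≈A ⟩
      A S.* inverse H          ∎)
      where
      inverseʳ : H S.* inverse H S.≈ S.1#
      inverseʳ = inverse-correct H denominator-zero

      inverseˡ : inverse H S.* H S.≈ S.1#
      inverseˡ = S.trans (S.*-comm (inverse H) H) inverseʳ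

------------------------------------------------------------------------
-- Maximum sets of nonoverlapping matches

module _ {Υ : Pred (Array k 2) ℓ} (Υ? : Decidable Υ) where

  -- Whether u and v, as consecutive columns, form a match.
  match : Vec ℕ k → Vec ℕ k → Bool
  match u v = does (Υ? (red (u ∷ v ∷ [])))

  match-invariant : ∀ {σ : ℕ → ℕ} → σ Preserves _<_ ⟶ _<_ →
                    ∀ u v → match (Vec.map σ u) (Vec.map σ v) ≡ match u v
  match-invariant σ-mono u v = ≡.cong (does ∘ Υ?) (red-map σ-mono (u ∷ v ∷ []))

  open Matches match

  -- Positions that are moved on by one column overlap if and only if the original
  -- ones do.
  overlap-suc : {i j : Fin m} → Overlap i j → Overlap (Fin.suc i) (Fin.suc j)
  overlap-suc (c , ∈i , ∈j) = Fin.suc c , VecMembership.∈-map⁺ Fin.suc ∈i , VecMembership.∈-map⁺ Fin.suc ∈j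

  overlap-pred : {i j : Fin m} → Overlap (Fin.suc i) (Fin.suc j) → Overlap i j
  overlap-pred (Fin.zero  , here () , _)
  overlap-pred (Fin.zero  , there (here ()) , _)
  overlap-pred (Fin.suc c , ∈i , ∈j) = c , pred ∈i , pred ∈j
    where
    pred : ∀ {p n} {c : Fin p} {xs : Vec (Fin p) n} → Fin.suc c Vec.∈ Vec.map Fin.suc xs → c Vec.∈ xs
    pred {xs = _ ∷ _} (here eq)  = here (Fin.suc-injective eq)
    pred {xs = _ ∷ _} (there c∈) = there (pred c∈)

  ¬overlap-0-2+ : {i : Fin m} → ¬ Overlap Fin.zero (Fin.suc (Fin.suc i))
  ¬overlap-0-2+ (_ , here ≡.refl          , there (here ()))
  ¬overlap-0-2+ (_ , there (here ≡.refl)  , there (here ()))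

  overlap-sym : {i j : Fin m} → Overlap i j → Overlap j i
  overlap-sym (c , ∈i , ∈j) = c , ∈j , ∈i

  -- Sets of pairwise nonoverlapping matches, abbreviated NM, of an array with and
  -- without its first column.
  NM-tail : ∀ {u} {F : Array k (suc m)} {s S} →
            NonoverlappingMatches Υ (u ∷ F) (s ∷ S) → NonoverlappingMatches Υ F S
  NM-tail {F = _ ∷ _} (matches , apart) =
    (λ i i∈ → matches (Fin.suc i) (there i∈)) ,
    (λ i j i∈ j∈ i≢j o → apart (Fin.suc i) (Fin.suc j) (there i∈) (there j∈)
                           (i≢j ∘ Fin.suc-injective) (overlap-suc o))

  NM-outside : ∀ {u} {F : Array k (suc m)} {S} →
               NonoverlappingMatches Υ F S → NonoverlappingMatches Υ (u ∷ F) (outside ∷ S)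
  NM-outside {F = _ ∷ _} (matches , apart) =
    (λ { (Fin.suc i) (there i∈) → matches i i∈ }) ,
    (λ { (Fin.suc i) (Fin.suc j) (there i∈) (there j∈) i≢j o →
           apart i j i∈ j∈ (i≢j ∘ ≡.cong Fin.suc) (overlap-pred o) })

  NM-inside : ∀ {u v w} {F : Array k m} {S} → Υ (red (u ∷ v ∷ [])) →
              NonoverlappingMatches Υ (w ∷ F) S →
              NonoverlappingMatches Υ (u ∷ v ∷ w ∷ F) (inside ∷ outside ∷ S)
  NM-inside {u = u} {v} {w} {F} {S} uv∈Υ nm = matches′ , apart′
    where
    shifted = NM-outside {u = u} {F = v ∷ w ∷ F} (NM-outside {u = v} {F = w ∷ F} nm)

    matches′ : ∀ i → i Subset.∈ (inside ∷ outside ∷ S) → MatchAt Υ (u ∷ v ∷ w ∷ F) i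
    matches′ Fin.zero    _          = uv∈Υ
    matches′ (Fin.suc i) (there i∈) = proj₁ shifted (Fin.suc i) (there i∈)

    apart′ : ∀ i j → i Subset.∈ (inside ∷ outside ∷ S) → j Subset.∈ (inside ∷ outside ∷ S) →
             i ≢ j → ¬ Overlap i j
    apart′ Fin.zero    Fin.zero    _ _ i≢j _ = i≢j ≡.refl
    apart′ Fin.zero    (Fin.suc (Fin.suc j)) _ _ _ o = ¬overlap-0-2+ o
    apart′ (Fin.suc (Fin.suc i)) Fin.zero    _ _ _ o = ¬overlap-0-2+ (overlap-sym o)
    apart′ Fin.zero (Fin.suc Fin.zero) _ (there ()) _ _
    apart′ (Fin.suc Fin.zero) Fin.zero (there ()) _ _ _
    apart′ (Fin.suc i) (Fin.suc j) (there i∈) (there j∈) i≢j o =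
      proj₂ shifted (Fin.suc i) (Fin.suc j) (there i∈) (there j∈) i≢j o

  -- The greedy count is an upper bound, by induction on the number of columns.  If
  -- the first position is in S, then the second is not, and the remaining positions lie
  -- in the array without its first two columns.  Otherwise S lies in the array
  -- without its first column, whose greedy count is not larger.
  NM-bound : ∀ (F : Array k (suc m)) S → NonoverlappingMatches Υ F S → ∣ S ∣ ≤ greedy F
  NM-bound (u ∷ [])        []            _  = z≤n
  NM-bound (u ∷ v ∷ F)     (outside ∷ S) nm =
    ℕ.≤-trans (NM-bound (v ∷ F) S (NM-tail nm)) (proj₁ (greedy-tail u (v ∷ F)))
  NM-bound (u ∷ v ∷ [])    (inside ∷ []) (matches , _)
    rewrite dec-true (Υ? (red (u ∷ v ∷ []))) (matches Fin.zero here) = s≤s z≤n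
  NM-bound (u ∷ v ∷ w ∷ F) (inside ∷ inside ∷ S) (_ , apart) =
    contradiction (Fin.suc Fin.zero , there (here ≡.refl) , here ≡.refl)
      (apart Fin.zero (Fin.suc Fin.zero) here (there here) λ ())
  NM-bound (u ∷ v ∷ w ∷ F) (inside ∷ outside ∷ S) nm@(matches , _)
    rewrite dec-true (Υ? (red (u ∷ v ∷ []))) (matches Fin.zero here) =
    s≤s (NM-bound (w ∷ F) S (NM-tail {u = v} {w ∷ F} (NM-tail {u = u} {v ∷ w ∷ F} nm)))

  NM-attained : ∀ (F : Array k (suc m)) → ∃ λ S → NonoverlappingMatches Υ F S × ∣ S ∣ ≡ greedy F
  NM-attained (u ∷ [])     = [] , ((λ ()) , (λ ())) , ≡.refl
  NM-attained (u ∷ v ∷ []) with Υ? (red (u ∷ v ∷ []))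
  ... | yes uv∈Υ = inside ∷ [] ,
    ((λ { Fin.zero _ → uv∈Υ }) , λ { Fin.zero Fin.zero _ _ i≢j _ → i≢j ≡.refl }) , ≡.refl
  ... | no  _    = outside ∷ [] , ((λ { Fin.zero () }) , λ { Fin.zero _ () }) , ≡.refl
  NM-attained (u ∷ v ∷ w ∷ F)
    with Υ? (red (u ∷ v ∷ [])) | NM-attained (v ∷ w ∷ F) | NM-attained (w ∷ F)
  ... | yes uv∈Υ | _            | S , nm , eq =
    inside ∷ outside ∷ S , NM-inside uv∈Υ nm , ≡.cong suc eq
  ... | no  _    | S , nm , eq  | _           = outside ∷ S , NM-outside nm , eq

  nlap≡greedy : ∀ (F : Array k (suc m)) → nlap Υ? F ≡ greedy F
  nlap≡greedy {m} F with S , nm , eq ← NM-attained F = ≡.trans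
    (max≈v⁺
      (∈-map⁺ ∣_∣ (∈-filter⁺ (nonoverlappingMatches? Υ? F) (∈-vectors (all-sides S)) nm))
      (All.map⁺ (All.map
        (λ {S′} nm′ → ≡.subst (∣ S′ ∣ ≤_) (≡.sym eq) (NM-bound F S′ nm′))
        (All.all-filter (nonoverlappingMatches? Υ? F) (vectors (outside ∷ inside ∷ []) m))))
      z≤n)
    eq
    where
    all-sides : ∀ {n} (S : Subset n) → VecAll.All (_∈ (outside ∷ inside ∷ [])) S
    all-sides []            = []
    all-sides (outside ∷ S) = here ≡.refl ∷ all-sides S
    all-sides (inside ∷ S)  = there (here ≡.refl) ∷ all-sides S

  noMatch≡matchFree : ∀ (F : Array k (suc m)) → does (noMatch? Υ? F) ≡ matchFree F
  noMatch≡matchFree (u ∷ [])    = dec-true (noMatch? Υ? (u ∷ [])) λ ()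
  noMatch≡matchFree (u ∷ v ∷ F) = cases (Υ? (red (u ∷ v ∷ [])))
    where
    cases : (d : Dec (Υ (red (u ∷ v ∷ [])))) →
            does (noMatch? Υ? (u ∷ v ∷ F)) ≡ (if does d then false else matchFree (v ∷ F))
    cases (yes uv∈Υ) = dec-false (noMatch? Υ? (u ∷ v ∷ F)) λ none → none Fin.zero uv∈Υ
    cases (no  uv∉Υ) = ≡.trans
      (does-⇔ (mk⇔ (λ none → none ∘ Fin.suc)
                   (λ none → λ { Fin.zero → uv∉Υ ; (Fin.suc i) → none i }))
              (noMatch? Υ? (u ∷ v ∷ F)) (noMatch? Υ? (v ∷ F)))
      (noMatch≡matchFree (v ∷ F))

------------------------------------------------------------------------
-- The generating functions over the rational polynomials

module ℚ[x]-Properties where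
  ring : CommutativeRing _ _
  ring = PolynomialRing.commutativeRing ℚ.+-*-commutativeRing

  open RawMonoidDefinitions ℚ.+-0-rawMonoid using () renaming (_×_ to _·_)

  multiple-of-inverse : ∀ m d → m · (ℤ.+ 1 ℚ./ suc d) ≡ ℤ.+ m ℚ./ suc d
  multiple-of-inverse zero    d = ℚ.fromℚᵘ-cong {ℚᵘ.0ℚᵘ} {ℚᵘ.mkℚᵘ (ℤ.+ 0) d} (ℚᵘ.*≡* ≡.refl)
  multiple-of-inverse (suc m) d = ≡.trans (≡.cong ((ℤ.+ 1 ℚ./ suc d) ℚ.+_) (multiple-of-inverse m d))
    (ℚ.toℚᵘ-injective (begin
      ℚ.toℚᵘ ((ℤ.+ 1 ℚ./ D) ℚ.+ (ℤ.+ m ℚ./ D))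
        ≈⟨ ℚ.toℚᵘ-homo-+ (ℤ.+ 1 ℚ./ D) (ℤ.+ m ℚ./ D) ⟩
      ℚ.toℚᵘ (ℤ.+ 1 ℚ./ D) ℚᵘ.+ ℚ.toℚᵘ (ℤ.+ m ℚ./ D)
        ≈⟨ ℚᵘ.+-cong (ℚ.toℚᵘ-fromℚᵘ (ℚᵘ.mkℚᵘ (ℤ.+ 1) d)) (ℚ.toℚᵘ-fromℚᵘ (ℚᵘ.mkℚᵘ (ℤ.+ m) d)) ⟩
      ℚᵘ.mkℚᵘ (ℤ.+ 1) d ℚᵘ.+ ℚᵘ.mkℚᵘ (ℤ.+ m) d
        ≈⟨ ℚᵘ.*≡* common ⟩
      ℚᵘ.mkℚᵘ (ℤ.+ suc m) d
        ≈⟨ ℚ.toℚᵘ-fromℚᵘ (ℚᵘ.mkℚᵘ (ℤ.+ suc m) d) ⟨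
      ℚ.toℚᵘ (ℤ.+ suc m ℚ./ D) ∎))
    where
    open ≈-Reasoning ℚᵘ.≃-setoid
    D = suc d

    common : (ℤ.+ 1 ℤ.* ℤ.+ D ℤ.+ ℤ.+ m ℤ.* ℤ.+ D) ℤ.* ℤ.+ D ≡ ℤ.+ suc m ℤ.* (ℤ.+ D ℤ.* ℤ.+ D)
    common = ≡.trans (≡.cong (ℤ._* ℤ.+ D) (≡.sym (ℤ.*-distribʳ-+ (ℤ.+ D) (ℤ.+ 1) (ℤ.+ m))))
                     (ℤ.*-assoc (ℤ.+ suc m) (ℤ.+ D) (ℤ.+ D))

  multiple-of-own-inverse : ∀ n .{{_ : NonZero n}} → n · (ℤ.+ 1 ℚ./ n) ≡ ℚ.1ℚ
  multiple-of-own-inverse (suc d) = ≡.trans (multiple-of-inverse (suc d) d)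
    (ℚ.fromℚᵘ-cong {ℚᵘ.mkℚᵘ (ℤ.+ suc d) d} {ℚᵘ.1ℚᵘ}
      (ℚᵘ.*≡* (ℤ.*-comm (ℤ.+ suc d) (ℤ.+ 1))))

  inverses : InverseFactorials ring
  inverses = record
    { inv!         = λ n → ℚ[x].const (1/ n !)
    ; inv!-correct = λ n i → ≡.trans
        (PolynomialRing.·-constant ℚ.+-*-commutativeRing (n !) (1/ n !) i)
        (≡.cong (λ q → Polynomial.coeff ℚ.+-*-rawRing (ℚ[x].const q) i)
                (multiple-of-own-inverse (n !) {{n ℕ.!≢0}}))
    }

-- The coefficients of the generating functions in the number of nonoverlapping
-- matches and of the match-free fillings, over any ring with inverse factorials.
module Coefficients {c ℓ₁ ℓ : Level} (R : CommutativeRing c ℓ₁) (inverses : InverseFactorials R)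
  (x : CommutativeRing.Carrier R) {k : ℕ} {Υ : Pred (Array k 2) ℓ} (Υ? : Decidable Υ) where

  open CommutativeRing R hiding (zero)
  open RawSemiringDefinitions (RawRing.rawSemiring rawRing) using (_^_)
  open ListSum R
  open GeneratingFunction R inverses k using (egf; egf-zero)
  open InverseFactorials inverses using (inv!)
  open MatchIdentity R inverses k (match Υ?) (match-invariant Υ?) x public
  open Mult semiring using () renaming (_×_ to _·_)

  -- The generating functions have the constant term 1 by definition; here it is
  -- the contribution of the empty array.
  nlap-zero : 1# ≈ egf greedyʷ 0
  nlap-zero = sym (egf-zero greedyʷ)

  matchFree-zero : 1# ≈ egf matchFreeʷ 0
  matchFree-zero = sym (egf-zero matchFreeʷ)

  -- The fillings are summed in the order in which they are enumerated by
  -- splitting their set of labels.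
  nlap-coefficient : ∀ m →
    inv! (k ℕ.* suc m) * ∑ (𝓕 (suc m) k) (λ F → x ^ nlap Υ? F) ≈ egf greedyʷ (suc m)
  nlap-coefficient m = *-congˡ (trans
    (∑-↭ (λ F → x ^ nlap Υ? F) (𝓕↭fillings (suc m) k))
    (∑-cong (fillings (suc m) [1⋯ k ℕ.* suc m ]) λ {F} _ → reflexive (≡.cong (x ^_) (nlap≡greedy Υ? F))))

  matchFree-coefficient : ∀ m →
    inv! (k ℕ.* suc m) * matchFreeCount Υ? m · 1# ≈ egf matchFreeʷ (suc m)
  matchFree-coefficient m = *-congˡ (trans (∑-filter (noMatch? Υ?) (𝓕 (suc m) k))
    (trans (∑-↭ (λ F → if does (noMatch? Υ? F) then 1# else 0#) (𝓕↭fillings (suc m) k))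
    (∑-cong (fillings (suc m) [1⋯ k ℕ.* suc m ]) λ {F} _ → reflexive (if-cong (noMatch≡matchFree Υ? F)))))

module _ {ℓ : Level} {k : ℕ} {Υ : Pred (Array k 2) ℓ} (Υ? : Decidable Υ) where
  open ℚ[x]-Properties
  open Coefficients ring inverses ℚ[x].x Υ?
  open GeneratingFunction ring inverses k using (egf)

  N-egf : N Υ? Series.≈ egf greedyʷ
  N-egf zero    = nlap-zero
  N-egf (suc m) = nlap-coefficient m

  A-egf : A Υ? Series.≈ egf matchFreeʷ
  A-egf zero    = matchFree-zero
  A-egf (suc m) = matchFree-coefficient m

open ℚ[x]-Properties using (ring; inverses)
open Series

theorem3 : ∀ {ℓ : Level} (k : ℕ) → 1 ≤ k →
    (Υ : Pred (Array k 2) ℓ) (Υ? : Decidable Υ) → Υ ⊆ IsFilling →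
    N Υ? ≈ A Υ? / (1# - x * (1# + (t * const (1/ k !) - 1#) * A Υ?))
theorem3 k _ Υ Υ? _ =
  Coefficients.quotient ring inverses ℚ[x].x Υ? {A Υ?} {N Υ?} (A-egf Υ?) (N-egf Υ?)
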